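{- Let $N,K,R$ be positive integers with $N=KR$, and let $n$ be a positive integer. Given a minimal closed clockwise path $\langle a_0/b_0,\dots,a_n/b_n\rangle$ in $\mathscr{F}_R$ of length $n$ (extended to all $i\in\mathbb{Z}$ by $a_{i+n}=-a_i$, $b_{i+n}=-b_i$), define \[ m_{ij}=\frac{1}{R}(a_jb_i-b_ja_i),\qquad 0\le i-j\le n. \] Then $(m_{ij})$ is a positive frieze over $\tfrac1N\mathbb{Z}$ of width $n$ with greatest common divisor $K$, it depends only on the $\mathrm{SL}_2(\mathbb{Z})$-orbit of the path, and the induced map \[ \mathrm{SL}_2(\mathbb{Z})\backslash\{\text{minimal closed clockwise paths in }\mathscr{F}_R\text{ of length }n\}\longrightarrow\{\text{positive friezes over }\tfrac1N\mathbb{Z}\text{ of width }n\text{ with greatest common divisor }K\} \] is a one-to-one correspondence.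
   Context: For a positive integer $R$, $\mathscr{F}_R$ is the directed graph whose vertices are pairs $(a,b)\in\mathbb{Z}^2\setminus\{(0,0)\}$ with $\gcd(a,b)$ dividing $R$, written $a/b$, with a directed edge from $a/b$ to $c/d$ iff $ad-bc=R$. A vertex $a/b$ is also regarded as the point $a/b$ of $\mathbb{R}_\infty=\mathbb{R}\cup\{\infty\}$ (with $a/0=\infty$). $\mathbb{R}_\infty$ carries the cyclic order inherited from the unit circle via stereographic projection, oriented so that a decreasing sequence of reals is clockwise (e.g. $-1,\infty,1$ is clockwise). A closed clockwise path in $\mathscr{F}_R$ of length $n$ is a sequence $\langle a_0/b_0,a_1/b_1,\dots,a_n/b_n\rangle$ of vertices with $a_{i-1}b_i-b_{i-1}a_i=R$ for $i=1,\dots,n$, $a_n=-a_0$, $b_n=-b_0$, and such that the points $a_0/b_0,\dots,a_{n-1}/b_{n-1}$ of $\mathbb{R}_\infty$ are in strict clockwise order and complete less than one full cycle of $\mathbb{R}_\infty$. It is minimal if the gcd of all integers $a_jb_i-b_ja_i$ (over all indices, equivalently over the bi-infinite extension) is $1$. $\mathrm{SL}_2(\mathbb{Z})$ acts on such paths by acting on each vertex $(a_i,b_i)^T$ by matrix multiplication. A rational frieze of width $n$ is a function $(i,j)\mapsto m_{ij}\in\mathbb{Q}$ on $\{(i,j)\in\mathbb{Z}^2:0\le i-j\le n\}$ with $m_{i,i}=m_{i+n,i}=0$ and $m_{i+1,i}=m_{i+n,i+1}=1$ for all $i$, and $m_{i,j}m_{i+1,j+1}-m_{i,j+1}m_{i+1,j}=1$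 whenever $0<i-j<n$. It is positive if all its nonzero entries are positive (equivalently $m_{ij}>0$ for $0<i-j<n$), and it is over $\tfrac1N\mathbb{Z}$ if all entries lie in $\tfrac1N\mathbb{Z}$. The greatest common divisor of a positive frieze over $\tfrac1N\mathbb{Z}$ is the gcd of the integers $Nm_{ij}$, $0\le i-j\le n$ (equivalently, of all entries of $N$ times the unique bi-infinite $\mathrm{SL}_2$-tiling extending the frieze with $m_{i+n,j}=m_{i,j+n}=-m_{ij}$). -}

module Defs where

open import Data.Nat as ℕ using (ℕ; NonZero)
open import Data.Integer as ℤ using (ℤ; +_; -[1+_])
open import Data.Integer.Divisibility using (_∣_)
open import Data.Integer.GCD using (gcd)
open import Data.Rational as ℚ using (ℚ)
open import Data.Product using (Σ; ∃; _×_; _,_; proj₁; proj₂)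
open import Data.Sum using (_⊎_)
open import Relation.Binary.PropositionalEquality using (_≡_; _≢_)
open import Relation.Nullary using (¬_)

Vec2 : Set
Vec2 = ℤ × ℤ

det : Vec2 → Vec2 → ℤ
det (a , b) (c , d) = a ℤ.* d ℤ.- b ℤ.* c

neg : Vec2 → Vec2
neg (a , b) = (ℤ.- a , ℤ.- b)

IsVertex : ℕ → Vec2 → Set
IsVertex R (a , b) = ¬ ((a ≡ + 0) × (b ≡ + 0)) × (gcd a b ∣ + R)

-- ℝ∞ restricted to the points we need: ℚ ∪ {∞}

data ℚ∞ : Set where
  ∞   : ℚ∞
  fin : ℚ → ℚ∞

point : Vec2 → ℚ∞
point (a , + 0)          = ∞
point (a , + (ℕ.suc k))  = fin (a ℚ./ ℕ.suc k)
point (a , -[1+ k ])     = fin ((ℤ.- a) ℚ./ ℕ.suc k)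

-- strict order on ℚ∞, with ∞ placed at the top (ℝ∞ cut open at ∞)
infix 4 _>∞_
data _>∞_ : ℚ∞ → ℚ∞ → Set where
  ∞>fin : ∀ {q} → ∞ >∞ fin q
  fin>  : ∀ {p q} → q ℚ.< p → fin p >∞ fin q

-- (x , y , z) is in strict clockwise order on ℝ∞
-- (a decreasing triple of reals is clockwise, and cyclic rotations thereof)
Clockwise : ℚ∞ → ℚ∞ → ℚ∞ → Set
Clockwise x y z =
  ((x >∞ y) × (y >∞ z)) ⊎ ((y >∞ z) × (z >∞ x)) ⊎ ((z >∞ x) × (x >∞ y))

-- Paths.  A closed path of length n is represented by its bi-infinite
-- extension v : ℤ → ℤ², v (i + n) = - v i; the paper's path is
-- ⟨v 0, …, v n⟩.

infix 4 _≤ℤ_ _∣ℚ_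
_≤ℤ_ : ℤ → ℤ → Set
_≤ℤ_ = ℤ._≤_

InRange : ℕ → ℤ → Set
InRange n i = (+ 0 ≤ℤ i) × (i ≤ℤ + n)

record ClosedCWPath (R n : ℕ) (v : ℤ → Vec2) : Set where
  field
    antiperiodic : ∀ i → v (i ℤ.+ + n) ≡ neg (v i)
    vertices     : ∀ i → InRange n i → IsVertex R (v i)
    edges        : ∀ i → + 1 ≤ℤ i → i ≤ℤ + n → det (v (i ℤ.- + 1)) (v i) ≡ + R
    -- the points v 0, …, v (n-1) are in strict clockwise order,
    -- completing less than one full cycle
    distinct     : ∀ i j → + 0 ≤ℤ i → i ℤ.< j → j ℤ.< + n →
                   point (v i) ≢ point (v j)
    clockwise    : ∀ i j k → + 0 ≤ℤ i → i ℤ.< j → j ℤ.< k → k ℤ.< + n →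
                   Clockwise (point (v i)) (point (v j)) (point (v k))

Minimal : ℕ → (ℤ → Vec2) → Set
Minimal n v = ∀ (d : ℤ) →
  (∀ i j → InRange n i → InRange n j → d ∣ det (v j) (v i)) → d ∣ + 1

MinimalClosedCWPath : ℕ → ℕ → (ℤ → Vec2) → Set
MinimalClosedCWPath R n v = ClosedCWPath R n v × Minimal n v

record SL₂ℤ : Set where
  constructor mat
  field
    α β γ δ : ℤ
    det≡1   : α ℤ.* δ ℤ.- β ℤ.* γ ≡ + 1

act : SL₂ℤ → Vec2 → Vec2
act g (a , b) = (α ℤ.* a ℤ.+ β ℤ.* b , γ ℤ.* a ℤ.+ δ ℤ.* b)
  where open SL₂ℤ g

actPath : SL₂ℤ → (ℤ → Vec2) → (ℤ → Vec2)
actPath g v i = act g (v i)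

SameOrbit : (ℤ → Vec2) → (ℤ → Vec2) → Set
SameOrbit v w = Σ SL₂ℤ λ g → ∀ i → w i ≡ act g (v i)

Array : Set
Array = ℤ → ℤ → ℚ

InStrip : ℕ → ℤ → ℤ → Set
InStrip n i j = (+ 0 ≤ℤ (i ℤ.- j)) × ((i ℤ.- j) ≤ℤ + n)

Interior : ℕ → ℤ → ℤ → Set
Interior n i j = (+ 0 ℤ.< (i ℤ.- j)) × ((i ℤ.- j) ℤ.< + n)

0ℚ 1ℚ : ℚ
0ℚ = + 0 ℚ./ 1
1ℚ = + 1 ℚ./ 1

-- rational frieze of width n (only values on the strip are relevant)
record IsFrieze (n : ℕ) (m : Array) : Set where
  field
    diag₀   : ∀ i → m i i ≡ 0ℚ
    diagₙ   : ∀ i → m (i ℤ.+ + n) i ≡ 0ℚ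
    diag₁   : ∀ i → m (i ℤ.+ + 1) i ≡ 1ℚ
    diagₙ₋₁ : ∀ i → m (i ℤ.+ + n) (i ℤ.+ + 1) ≡ 1ℚ
    diamond : ∀ i j → Interior n i j →
              m i j ℚ.* m (i ℤ.+ + 1) (j ℤ.+ + 1)
                ℚ.- m i (j ℤ.+ + 1) ℚ.* m (i ℤ.+ + 1) j ≡ 1ℚ

IsPositive : ℕ → Array → Set
IsPositive n m = ∀ i j → Interior n i j → 0ℚ ℚ.< m i j

_∣ℚ_ : ℤ → ℚ → Set
d ∣ℚ q = ∃ λ (k : ℤ) → q ≡ (k ℤ.* d) ℚ./ 1

scale : ℕ → ℚ → ℚ
scale N q = (+ N ℚ./ 1) ℚ.* q

OverInvZ : ℕ → ℕ → Array → Set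
OverInvZ N n m = ∀ i j → InStrip n i j → + 1 ∣ℚ scale N (m i j)

GCDIs : ℕ → ℕ → ℕ → Array → Set
GCDIs N n K m =
  (∀ i j → InStrip n i j → + K ∣ℚ scale N (m i j)) ×
  (∀ (d : ℤ) → (∀ i j → InStrip n i j → d ∣ℚ scale N (m i j)) → d ∣ + K)

PositiveFriezeGCD : ℕ → ℕ → ℕ → Array → Set
PositiveFriezeGCD N n K m =
  IsFrieze n m × IsPositive n m × OverInvZ N n m × GCDIs N n K m

_≈[_]_ : Array → ℕ → Array → Set
m ≈[ n ] m' = ∀ i j → InStrip n i j → m i j ≡ m' i j

friezeOf : (R : ℕ) .{{_ : NonZero R}} → (ℤ → Vec2) → Array
friezeOf R v i j = det (v j) (v i) ℚ./ R

{-# OPTIONS --safe #-}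
module Submission where

-- For nonzero u, v, w ∈ ℤ² the points u, v, w are in clockwise order iff
-- det(u,v) det(v,w) det(u,w) > 0. Hence a closed path is clockwise iff det(v_j,v_i) > 0 for all
-- 0 < i - j < n, and the diamond rule for these determinants is a Plücker relation.
--
-- Injectivity: let Σ c_ij det(v_j,v_i) = 1. If det(w_j,w_i) = det(v_j,v_i) for all i, j, Cramer's rule
-- shows that the integral map x ↦ Σ c_ij (det(x,v_i) w_j + det(v_j,x) w_i) sends each v_k to w_k.
--
-- Surjectivity: positivity forces both the rows and the columns of z = R m to satisfy the same
-- second-order recurrence, whence z(i+n,j+n) = z(i,j), z(j+n,i) = z(i,j) and
-- R z(i,j) = x_j y_i - y_j x_i for x_i = z(i,-1) and y_i = z(i,0). If s = Σ c_k y_k is the gcd of the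
-- y_i and q = Σ c_k x_k, then R divides x_i s - q y_i, and the vectors ((x_i s - q y_i) / R , y_i / s)
-- have determinants z(i,j).

open import Defs
open import Data.Nat as ℕ using (ℕ; zero; suc; NonZero; z≤n; s≤s)
import Data.Nat.Properties as ℕₚ
import Data.Nat.GCD as ℕGCD
open import Data.Integer as ℤ using (ℤ; +_; -[1+_]; _+_; _*_; _-_; -_; _<_; _≤_; +<+; +≤+)
import Data.Integer.Properties as ℤₚ
import Algebra.Properties.AbelianGroup ℤₚ.+-0-abelianGroup as ℤ+
open import Data.Integer.DivMod using (_/ℕ_; _%ℕ_; n%ℕd<d; a≡a%ℕn+[a/ℕn]*n)
open import Data.Integer.Divisibility.Signed
  using (_∣_; divides; ∣ᵤ⇒∣; ∣⇒∣ᵤ; ∣-trans; m∣∣m∣; ∣m⇒∣-m; ∣n⇒∣m*n; ∣m⇒∣m*n; ∣m∣n⇒∣m-n; ∣m∣n⇒∣m+n)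
open import Data.Integer.GCD using (gcd; gcd[i,j]∣i; gcd[i,j]∣j)
open import Data.Integer.Tactic.RingSolver using (solve-∀)
open import Data.Rational as ℚ using (ℚ)
import Data.Rational.Properties as ℚₚ
open import Data.Rational.Unnormalised as ℚᵘ using (mkℚᵘ; *≡*)
import Data.Rational.Unnormalised.Properties as ℚᵘₚ
open import Data.Product using (Σ; ∃; _×_; _,_; proj₁; proj₂)
open import Data.Sum using (_⊎_; inj₁; inj₂)
open import Data.Empty using (⊥; ⊥-elim)
open import Relation.Binary.PropositionalEquality
open import Relation.Nullary using (¬_; Dec; yes; no)

-- Ideals of ℤ and common divisors of finite families.

-- A gcd of a finite family is an integer combination of its members, so a property closed under
-- combinations passes from the members to the gcd. This serves twice: for `Rowwise` (injectivity)
-- and for `Compatible` (surjectivity).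
record IsIdeal (P : ℤ → Set) : Set where
  field
    has0 : P (+ 0)
    comb : ∀ x y {a b} → P a → P b → P (x * a + y * b)

bézout : ∀ a b → ∃ λ g → g ∣ a × g ∣ b × ∃ λ x → ∃ λ y → g ≡ x * a + y * b
bézout a b = from (ℕGCD.Bézout.lemma ℤ.∣ a ∣ ℤ.∣ b ∣)
  where
  open ℕGCD.Bézout
  lift : ∀ x y d m n → d ℕ.+ y ℕ.* n ≡ x ℕ.* m → + d ≡ + x * + m + (- (+ y)) * + n
  lift x y d m n eq = begin
    + d                                             ≡⟨ h (+ d) (+ y) (+ n) ⟩
    (+ d + + y * + n) + (- (+ y)) * + n             ≡⟨ cong (λ t → (+ d + t) + (- (+ y)) * + n) (ℤₚ.pos-* y n) ⟨
    + (d ℕ.+ y ℕ.* n) + (- (+ y)) * + n             ≡⟨ cong (λ t → + t + (- (+ y)) * + n) eq ⟩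
    + (x ℕ.* m) + (- (+ y)) * + n                   ≡⟨ cong (_+ (- (+ y)) * + n) (ℤₚ.pos-* x m) ⟩
    + x * + m + (- (+ y)) * + n                     ∎
    where
    open ≡-Reasoning
    h : ∀ d y n → d ≡ (d + y * n) + (- y) * n
    h = solve-∀
  from : Lemma ℤ.∣ a ∣ ℤ.∣ b ∣ → _
  from (result d g i) with m∣∣m∣ {a} | m∣∣m∣ {b}
  -- Here |a| = q a and |b| = r b, so the signs of a and b move into the Bézout coefficients.
  ... | divides q eqa | divides r eqb =
    + d , ∣ᵤ⇒∣ (ℕGCD.GCD.gcd∣m g) , ∣ᵤ⇒∣ (ℕGCD.GCD.gcd∣n g) , go i
    where
    h : ∀ x q a y r b → x * (q * a) + y * (r * b) ≡ (x * q) * a + (y * r) * b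
    h = solve-∀
    go : Identity d ℤ.∣ a ∣ ℤ.∣ b ∣ → ∃ λ x → ∃ λ y → + d ≡ x * a + y * b
    go (+- x y eq) = + x * q , (- (+ y)) * r ,
      trans (lift x y d _ _ eq) (trans (cong₂ (λ s t → + x * s + (- (+ y)) * t) eqa eqb) (h (+ x) q a (- (+ y)) r b))
    go (-+ x y eq) = (- (+ x)) * q , + y * r ,
      trans (lift y x d _ _ eq) (trans (ℤₚ.+-comm (+ y * + ℤ.∣ b ∣) ((- (+ x)) * + ℤ.∣ a ∣))
        (trans (cong₂ (λ s t → (- (+ x)) * s + + y * t) eqa eqb) (h (- (+ x)) q a (+ y) r b)))

-- D k g stands for "g divides the k-th block", so that finite families can be nested.
commonDivisor : ∀ {P} → IsIdeal P → (D : ℕ → ℤ → Set) → (∀ k {g h} → h ∣ g → D k g → D k h) →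
                ∀ n → (∀ k → k ℕ.< n → ∃ λ g → P g × D k g) →
                ∃ λ g → P g × (∀ k → k ℕ.< n → D k g)
commonDivisor I D closed zero    f = + 0 , IsIdeal.has0 I , λ _ ()
commonDivisor {P} I D closed (suc n) f
  with commonDivisor I D closed n (λ k k<n → f k (ℕₚ.m<n⇒m<1+n k<n)) | f n ℕₚ.≤-refl
... | g , Pg , Dg | h , Ph , Dh with bézout g h
... | c , c∣g , c∣h , x , y , c≡ = c , subst P (sym c≡) (IsIdeal.comb I x y Pg Ph) , λ k k<1+n → all k (ℕₚ.m≤n⇒m<n∨m≡n (ℕₚ.≤-pred k<1+n))
  where
  all : ∀ k → k ℕ.< n ⊎ k ≡ n → D k c
  all k (inj₁ k<n)  = closed k c∣g (Dg k k<n)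
  all k (inj₂ refl) = closed k c∣h Dh

-- Induction over ℤ by periods.

≤⇒offset : ∀ {i j} → j ≤ i → ∃ λ k → i ≡ j + + k
≤⇒offset {i} {j} j≤i with ℤ.∣ i - j ∣ in eq | ℤₚ.0≤i⇒+∣i∣≡i (ℤₚ.i≤j⇒0≤j-i j≤i)
... | k | e = k , trans (h i j) (cong (λ t → j + t) (sym e))
  where
  h : ∀ i j → i ≡ j + (i - j)
  h = solve-∀

signedShift : ∀ (Q : ℤ → Set) c → (∀ j → Q j → Q (j + c)) → (∀ j → Q (j + c) → Q j) →
              ∀ q j → Q j → Q (j + q * c)
signedShift Q c up down (+ zero)    j Qj = subst Q (h j c) Qj
  where
  h : ∀ j c → j ≡ j + + 0 * c
  h = solve-∀
signedShift Q c up down (+ suc q)   j Qj = subst Q (h j (+ q) c) (up _ (signedShift Q c up down (+ q) j Qj))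
  where
  h : ∀ j q c → j + q * c + c ≡ j + (+ 1 + q) * c
  h = solve-∀
signedShift Q c up down -[1+ zero ] j Qj = down _ (subst Q (h j c) Qj)
  where
  h : ∀ j c → j ≡ j + -[1+ 0 ] * c + c
  h = solve-∀
signedShift Q c up down -[1+ suc q ] j Qj = down _ (subst Q (h j (+ 1 + + q) c) (signedShift Q c up down -[1+ q ] j Qj))
  where
  h : ∀ j q c → j + (- q) * c ≡ j + (- (+ 1 + q)) * c + c
  h = solve-∀

-- Division with remainder reaches every integer from 0, ..., n-1 by steps of n; the downward
-- hypothesis serves negative quotients.
periodic-induction : ∀ n .{{_ : NonZero n}} (Q : ℤ → Set) →
  (∀ j → Q j → Q (j + + n)) → (∀ j → Q (j + + n) → Q j) →
  (∀ r → r ℕ.< n → Q (+ r)) → ∀ j → Q j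
periodic-induction n Q up down base j =
  subst Q (sym (a≡a%ℕn+[a/ℕn]*n j n))
    (signedShift Q (+ n) up down (j /ℕ n) _ (base (j %ℕ n) (n%ℕd<d j n)))

-- Determinants of pairs of integer vectors.

det-swap : ∀ u w → det u w ≡ - det w u
det-swap (a , b) (c , d) = h a b c d
  where
  h : ∀ a b c d → a * d - b * c ≡ - (c * b - d * a)
  h = solve-∀

det-self : ∀ u → det u u ≡ + 0
det-self (a , b) = h a b
  where
  h : ∀ a b → a * b - b * a ≡ + 0
  h = solve-∀

det-negʳ : ∀ u w → det u (neg w) ≡ - det u w
det-negʳ (a , b) (c , d) = h a b c d
  where
  h : ∀ a b c d → a * (- d) - b * (- c) ≡ - (a * d - b * c)
  h = solve-∀

det-neg : ∀ u w → det (neg u) (neg w) ≡ det u w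
det-neg (a , b) (c , d) = h a b c d
  where
  h : ∀ a b c d → (- a) * (- d) - (- b) * (- c) ≡ a * d - b * c
  h = solve-∀

-- For s, t, u, w = v_j, v_i, v_{j+1}, v_{i+1} the right side is a product of two edges, R · R: this
-- is the diamond rule.
plücker : ∀ s t u w → det s t * det u w - det u t * det s w ≡ det s u * det t w
plücker (a , b) (c , d) (e , f) (g , k) = h a b c d e f g k
  where
  h : ∀ a b c d e f g k →
      (a * d - b * c) * (e * k - f * g) - (e * d - f * c) * (a * k - b * g)
        ≡ (a * f - b * e) * (c * k - d * g)
  h = solve-∀

det-act : ∀ g u w → det (act g u) (act g w) ≡ det u w
det-act (mat α β γ δ αδ-βγ≡1) (a , b) (c , d) =
  trans (h α β γ δ a b c d) (trans (cong (_* (a * d - b * c)) αδ-βγ≡1) (ℤₚ.*-identityˡ _))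
  where
  h : ∀ α β γ δ a b c d →
      (α * a + β * b) * (γ * c + δ * d) - (γ * a + δ * b) * (α * c + β * d)
        ≡ (α * δ - β * γ) * (a * d - b * c)
  h = solve-∀

-- Cyclic order and determinants

i<j⇒0<j-i : ∀ {i j} → i < j → + 0 < j - i
i<j⇒0<j-i {i} {j} i<j = subst (_< j - i) (ℤₚ.+-inverseʳ i) (ℤₚ.+-monoˡ-< (- i) i<j)

0<i-j⇒j<i : ∀ {i j} → + 0 < i - j → j < i
0<i-j⇒j<i {i} {j} 0<d = subst₂ _<_ (ℤₚ.+-identityˡ j) (h i j) (ℤₚ.+-monoˡ-< j 0<d)
  where
  h : ∀ i j → i - j + j ≡ i
  h = solve-∀

*-pos : ∀ {i j} → + 0 < i → + 0 < j → + 0 < i * j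
*-pos {+ suc i} {+ suc j} _ _ = +<+ (s≤s z≤n)
*-pos {+ zero} (+<+ ())
*-pos {+ suc i} {+ zero} _ (+<+ ())

*-cancel-pos : ∀ i {j} → + 0 < i → + 0 < i * j → + 0 < j
*-cancel-pos (+ suc i) {j} _ p = ℤₚ.*-cancelˡ-<-nonNeg (+ suc i) (subst (_< + suc i * j) (sym (ℤₚ.*-zeroʳ (+ suc i))) p)
*-cancel-pos (+ zero) (+<+ ())

pos-dichotomy : ∀ {i} → i ≢ + 0 → + 0 < i ⊎ + 0 < - i
pos-dichotomy {+ zero}    i≢0 = ⊥-elim (i≢0 refl)
pos-dichotomy {+ suc i}   i≢0 = inj₁ (+<+ (s≤s z≤n))
pos-dichotomy { -[1+ i ]} i≢0 = inj₂ (+<+ (s≤s z≤n))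

¬pos-neg : ∀ {i} → + 0 < i → + 0 < - i → ⊥
¬pos-neg {+ zero}  (+<+ ())
¬pos-neg {+ suc i} _ ()

-- Canonical representatives of points: (a , 0) with 0 < a, and (a , b) with 0 < b.
data Represents : ℚ∞ → Vec2 → Set where
  atInfinity : ∀ k → Represents ∞ (+ suc k , + 0)
  atFinite   : ∀ a k → Represents (fin (a ℚ./ suc k)) (a , + suc k)

-- `ℚ./` reduces its fraction, so the comparison is moved to unnormalised rationals, whose order is
-- cross-multiplication by definition.
/-<⇒ : ∀ a k c l → a ℚ./ suc k ℚ.< c ℚ./ suc l → a * + suc l < c * + suc k
/-<⇒ a k c l p = ℚᵘₚ.drop-*<* (ℚᵘₚ.<-respˡ-≃ (ℚₚ.toℚᵘ-fromℚᵘ (ℚᵘ.mkℚᵘ a k))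
  (ℚᵘₚ.<-respʳ-≃ (ℚₚ.toℚᵘ-fromℚᵘ (ℚᵘ.mkℚᵘ c l)) (ℚₚ.toℚᵘ-mono-< p)))

/-<⇐ : ∀ a k c l → a * + suc l < c * + suc k → a ℚ./ suc k ℚ.< c ℚ./ suc l
/-<⇐ a k c l p = ℚₚ.toℚᵘ-cancel-< (ℚᵘₚ.<-respˡ-≃ (ℚᵘₚ.≃-sym (ℚₚ.toℚᵘ-fromℚᵘ (ℚᵘ.mkℚᵘ a k)))
  (ℚᵘₚ.<-respʳ-≃ (ℚᵘₚ.≃-sym (ℚₚ.toℚᵘ-fromℚᵘ (ℚᵘ.mkℚᵘ c l))) (ℚᵘ.*<* p)))

private
  det-atInfinity : ∀ a c d → a * d - + 0 * c ≡ a * d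
  det-atInfinity = solve-∀

  det-toInfinity : ∀ a b c → a * + 0 - b * c ≡ - (b * c)
  det-toInfinity = solve-∀

>∞⇒0<det : ∀ {p q u w} → Represents p u → Represents q w → p >∞ q → + 0 < det u w
>∞⇒0<det (atInfinity k) (atFinite c l) ∞>fin = subst (+ 0 <_) (sym (det-atInfinity (+ suc k) c (+ suc l))) (+<+ (s≤s z≤n))
>∞⇒0<det (atFinite a k) (atFinite c l) (fin> q<p) =
  subst (λ t → + 0 < a * + suc l - t) (ℤₚ.*-comm c (+ suc k)) (i<j⇒0<j-i (/-<⇒ c l a k q<p))

0<det⇒>∞ : ∀ {p q u w} → Represents p u → Represents q w → + 0 < det u w → p >∞ q
0<det⇒>∞ (atInfinity k) (atInfinity l) 0<d with subst (+ 0 <_) (det-toInfinity (+ suc k) (+ 0) (+ suc l)) 0<d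
... | +<+ ()
0<det⇒>∞ (atInfinity k) (atFinite c l) 0<d = ∞>fin
0<det⇒>∞ (atFinite a k) (atInfinity l) 0<d with subst (+ 0 <_) (det-toInfinity a (+ suc k) (+ suc l)) 0<d
... | ()
0<det⇒>∞ (atFinite a k) (atFinite c l) 0<d =
  fin> (/-<⇐ c l a k (0<i-j⇒j<i (subst (λ t → + 0 < a * + suc l - t) (ℤₚ.*-comm (+ suc k) c) 0<d)))

>∞-trans : ∀ {x y z} → x >∞ y → y >∞ z → x >∞ z
>∞-trans ∞>fin    (fin> _) = ∞>fin
>∞-trans (fin> p) (fin> q) = fin> (ℚₚ.<-trans q p)

-- Each vector occurs in two of the three factors, so changing the sign of a vector changes nothing:
-- the sign of the product depends only on the three points. It is invariant under rotation of the
-- triple and odd under reversal, as a cyclic order requires.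
orientation : Vec2 → Vec2 → Vec2 → ℤ
orientation u v w = det u v * det v w * det u w

private
  case₂ : ∀ u v w → orientation u v w ≡ det v w * det w u * det v u
  case₂ (a , b) (c , d) (e , f) = h a b c d e f
    where
    h : ∀ a b c d e f → (a * d - b * c) * (c * f - d * e) * (a * f - b * e)
          ≡ (c * f - d * e) * (e * b - f * a) * (c * b - d * a)
    h = solve-∀

  case₃ : ∀ u v w → orientation u v w ≡ det w u * det u v * det w v
  case₃ u v w = trans (case₂ u v w) (case₂ v w u)

  reverse : ∀ u v w → orientation w v u ≡ - orientation u v w
  reverse (a , b) (c , d) (e , f) = h a b c d e f
    where
    h : ∀ a b c d e f → (e * d - f * c) * (c * b - d * a) * (e * b - f * a)
          ≡ - ((a * d - b * c) * (c * f - d * e) * (a * f - b * e))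
    h = solve-∀

module _ {p q r u v w} (P : Represents p u) (Q : Represents q v) (R : Represents r w) where

  private
    descending : ∀ {p q r u v w} → Represents p u → Represents q v → Represents r w →
                p >∞ q → q >∞ r → + 0 < orientation u v w
    descending P Q R p>q q>r =
      *-pos (*-pos (>∞⇒0<det P Q p>q) (>∞⇒0<det Q R q>r)) (>∞⇒0<det P R (>∞-trans p>q q>r))

  Clockwise⇒0<orientation : Clockwise p q r → + 0 < orientation u v w
  Clockwise⇒0<orientation (inj₁ (p>q , q>r))        = descending P Q R p>q q>r
  Clockwise⇒0<orientation (inj₂ (inj₁ (q>r , r>p))) = subst (+ 0 <_) (sym (case₂ u v w)) (descending Q R P q>r r>p)
  Clockwise⇒0<orientation (inj₂ (inj₂ (r>p , p>q))) = subst (+ 0 <_) (sym (case₃ u v w)) (descending R P Q r>p p>q)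

compare∞ : ∀ {p q u w} → Represents p u → Represents q w → det u w ≢ + 0 → p >∞ q ⊎ q >∞ p
compare∞ {u = u} {w} P Q d≢0 with pos-dichotomy d≢0
... | inj₁ d>0 = inj₁ (0<det⇒>∞ P Q d>0)
... | inj₂ d<0 = inj₂ (0<det⇒>∞ Q P (subst (+ 0 <_) (sym (det-swap w u)) d<0))

module _ {p q r u v w} (P : Represents p u) (Q : Represents q v) (R : Represents r w) where

  private
    anticlockwise : + 0 < orientation u v w → Clockwise r q p → ⊥
    anticlockwise o>0 c = ¬pos-neg o>0 (subst (+ 0 <_) (reverse u v w) (Clockwise⇒0<orientation R Q P c))

    *-zeroᵐ : ∀ a b → a * + 0 * b ≡ + 0
    *-zeroᵐ = solve-∀

  -- No factor vanishes, so the points are pairwise comparable and either the triple or its reverse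
  -- is clockwise. The reverse would make the orientation negative.
  0<orientation⇒Clockwise : + 0 < orientation u v w → Clockwise p q r
  0<orientation⇒Clockwise o>0 = go (compare∞ P Q uv≢0) (compare∞ Q R vw≢0) (compare∞ P R uw≢0)
    where
    uv≢0 : det u v ≢ + 0
    uv≢0 e = ℤₚ.<-irrefl refl (subst (λ t → + 0 < t * det v w * det u w) e o>0)
    vw≢0 : det v w ≢ + 0
    vw≢0 e = ℤₚ.<-irrefl (sym (*-zeroᵐ (det u v) (det u w))) (subst (λ t → + 0 < det u v * t * det u w) e o>0)
    uw≢0 : det u w ≢ + 0
    uw≢0 e = ℤₚ.<-irrefl (sym (ℤₚ.*-zeroʳ (det u v * det v w))) (subst (λ t → + 0 < det u v * det v w * t) e o>0)
    go : p >∞ q ⊎ q >∞ p → q >∞ r ⊎ r >∞ q → p >∞ r ⊎ r >∞ p → Clockwise p q r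
    go (inj₁ p>q) (inj₁ q>r) _          = inj₁ (p>q , q>r)
    go (inj₁ p>q) (inj₂ r>q) (inj₂ r>p) = inj₂ (inj₂ (r>p , p>q))
    go (inj₂ q>p) (inj₁ q>r) (inj₂ r>p) = inj₂ (inj₁ (q>r , r>p))
    go (inj₁ p>q) (inj₂ r>q) (inj₁ p>r) = ⊥-elim (anticlockwise o>0 (inj₂ (inj₂ (p>r , r>q))))
    go (inj₂ q>p) (inj₁ q>r) (inj₁ p>r) = ⊥-elim (anticlockwise o>0 (inj₂ (inj₁ (q>p , p>r))))
    go (inj₂ q>p) (inj₂ r>q) _          = ⊥-elim (anticlockwise o>0 (inj₁ (r>q , q>p)))

NonZeroVec : Vec2 → Set
NonZeroVec (a , b) = ¬ ((a ≡ + 0) × (b ≡ + 0))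

infixr 7 _·_
_·_ : ℤ → Vec2 → Vec2
ε · (a , b) = ε * a , ε * b

-- A vector and its negative give the same point, so a representative exists only up to a sign ε.
-- Recording ε ε = 1 is the form in which the signs cancel in `orientation-±`.
canonical : ∀ u → NonZeroVec u → ∃ λ ε → ∃ λ u′ → ε * ε ≡ + 1 × u ≡ ε · u′ × Represents (point u) u′
canonical (+ zero , + zero)    u≢0 = ⊥-elim (u≢0 (refl , refl))
canonical (+ suc a , + zero)   u≢0 = + 1 , _ , refl , cong₂ _,_ (sym (ℤₚ.*-identityˡ _)) refl , atInfinity a
canonical (-[1+ a ] , + zero)  u≢0 = - + 1 , _ , refl , cong₂ _,_ (sym (ℤₚ.-1*i≡-i (+ suc a))) refl , atInfinity a
canonical (a , + suc b)        u≢0 = + 1 , _ , refl , cong₂ _,_ (sym (ℤₚ.*-identityˡ _)) (sym (ℤₚ.*-identityˡ _)) , atFinite a b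
canonical (a , -[1+ b ])       u≢0 = - + 1 , _ , refl ,
  cong₂ _,_ (trans (sym (ℤₚ.neg-involutive a)) (sym (ℤₚ.-1*i≡-i (- a)))) (sym (ℤₚ.-1*i≡-i (+ suc b))) , atFinite (- a) b

orientation-± : ∀ ε δ ζ u v w → ε * ε ≡ + 1 → δ * δ ≡ + 1 → ζ * ζ ≡ + 1 →
                orientation (ε · u) (δ · v) (ζ · w) ≡ orientation u v w
orientation-± ε δ ζ u@(a , b) v@(c , d) w@(e , f) ε² δ² ζ² =
  trans (h a b c d e f ε δ ζ)
    (trans (cong₂ _*_ (cong₂ _*_ (cong₂ _*_ ε² δ²) ζ²) refl) (ℤₚ.*-identityˡ (orientation u v w)))
  where
  h : ∀ a b c d e f ε δ ζ →
      ((ε * a) * (δ * d) - (ε * b) * (δ * c)) * ((δ * c) * (ζ * f) - (δ * d) * (ζ * e)) * ((ε * a) * (ζ * f) - (ε * b) * (ζ * e))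
        ≡ (ε * ε) * (δ * δ) * (ζ * ζ) * ((a * d - b * c) * (c * f - d * e) * (a * f - b * e))
  h = solve-∀

module _ (u v w : Vec2) (u≢0 : NonZeroVec u) (v≢0 : NonZeroVec v) (w≢0 : NonZeroVec w) where

  clockwise⇒orientation : Clockwise (point u) (point v) (point w) → + 0 < orientation u v w
  clockwise⇒orientation c with canonical u u≢0 | canonical v v≢0 | canonical w w≢0
  ... | ε , u′ , ε² , u≡ , U | δ , v′ , δ² , v≡ , V | ζ , w′ , ζ² , w≡ , W =
    subst (+ 0 <_) (sym (trans (cong₂ (λ f z → f z) (cong₂ orientation u≡ v≡) w≡) (orientation-± ε δ ζ u′ v′ w′ ε² δ² ζ²)))
      (Clockwise⇒0<orientation U V W c)

  orientation⇒clockwise : + 0 < orientation u v w → Clockwise (point u) (point v) (point w)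
  orientation⇒clockwise o with canonical u u≢0 | canonical v v≢0 | canonical w w≢0
  ... | ε , u′ , ε² , u≡ , U | δ , v′ , δ² , v≡ , V | ζ , w′ , ζ² , w≡ , W =
    0<orientation⇒Clockwise U V W
      (subst (+ 0 <_) (trans (cong₂ (λ f z → f z) (cong₂ orientation u≡ v≡) w≡) (orientation-± ε δ ζ u′ v′ w′ ε² δ² ζ²)) o)

0≢det⇒NonZeroˡ : ∀ u w → det u w ≢ + 0 → NonZeroVec u
0≢det⇒NonZeroˡ u (c , d) ≢0 (refl , refl) = ≢0 refl

0≢det⇒NonZeroʳ : ∀ u w → det u w ≢ + 0 → NonZeroVec w
0≢det⇒NonZeroʳ u w ≢0 w≡0 = 0≢det⇒NonZeroˡ w u (λ e → ≢0 (trans (det-swap u w) (cong -_ e))) w≡0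

>∞-irrefl : ∀ {p} → p >∞ p → ⊥
>∞-irrefl (fin> q<q) = ℚₚ.<-irrefl refl q<q

-- Up to sign the determinant decides a strict comparison of the two points, which equal points
-- cannot satisfy.
det≢0⇒point≢ : ∀ u w → det u w ≢ + 0 → point u ≢ point w
det≢0⇒point≢ u w d≢0 pu≡pw with canonical u (0≢det⇒NonZeroˡ u w d≢0) | canonical w (0≢det⇒NonZeroʳ u w d≢0)
... | ε , u′ , ε² , u≡ , U | δ , w′ , δ² , w≡ , W with compare∞ U W d′≢0
  where
  h : ∀ ε δ a b c d → (ε * a) * (δ * d) - (ε * b) * (δ * c) ≡ ε * δ * (a * d - b * c)
  h = solve-∀
  d′≢0 : det u′ w′ ≢ + 0
  d′≢0 e = d≢0 (trans (cong₂ det u≡ w≡) (trans (h ε δ (proj₁ u′) (proj₂ u′) (proj₁ w′) (proj₂ w′))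
    (trans (cong (ε * δ *_) e) (ℤₚ.*-zeroʳ (ε * δ)))))
... | inj₁ u>w = >∞-irrefl (subst (_>∞ point w) pu≡pw u>w)
... | inj₂ w>u = >∞-irrefl (subst (point w >∞_) pu≡pw w>u)

-- Fractions with a common denominator

private
  -- `a ℚ./ suc r` unfolds to `ℚ.fromℚᵘ (mkℚᵘ a r)`, so arithmetic with reduced fractions can be
  -- carried out on unreduced ones.
  fromℚᵘ-* : ∀ p q → ℚ.fromℚᵘ p ℚ.* ℚ.fromℚᵘ q ≡ ℚ.fromℚᵘ (p ℚᵘ.* q)
  fromℚᵘ-* p q = ℚₚ.toℚᵘ-injective
    (ℚᵘₚ.≃-trans (ℚₚ.toℚᵘ-homo-* (ℚ.fromℚᵘ p) (ℚ.fromℚᵘ q))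
    (ℚᵘₚ.≃-trans (ℚᵘₚ.*-cong (ℚₚ.toℚᵘ-fromℚᵘ p) (ℚₚ.toℚᵘ-fromℚᵘ q))
                 (ℚᵘₚ.≃-sym (ℚₚ.toℚᵘ-fromℚᵘ (p ℚᵘ.* q)))))

  fromℚᵘ-- : ∀ p q → ℚ.fromℚᵘ p ℚ.- ℚ.fromℚᵘ q ≡ ℚ.fromℚᵘ (p ℚᵘ.- q)
  fromℚᵘ-- p q = ℚₚ.toℚᵘ-injective
    (ℚᵘₚ.≃-trans (ℚₚ.toℚᵘ-homo-+ (ℚ.fromℚᵘ p) (ℚ.- ℚ.fromℚᵘ q))
    (ℚᵘₚ.≃-trans (ℚᵘₚ.+-cong (ℚₚ.toℚᵘ-fromℚᵘ p)
                   (ℚᵘₚ.≃-trans (ℚₚ.toℚᵘ-homo‿- (ℚ.fromℚᵘ q)) (ℚᵘₚ.-‿cong (ℚₚ.toℚᵘ-fromℚᵘ q))))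
                 (ℚᵘₚ.≃-sym (ℚₚ.toℚᵘ-fromℚᵘ (p ℚᵘ.- q)))))

/-injective : ∀ a b R S .{{_ : NonZero R}} .{{_ : NonZero S}} → a ℚ./ R ≡ b ℚ./ S → a * + S ≡ b * + R
/-injective a b (suc r) (suc s) eq = ℚᵘₚ.drop-*≡* (ℚₚ.fromℚᵘ-injective {mkℚᵘ a r} {mkℚᵘ b s} eq)

/-cross : ∀ a b R S .{{_ : NonZero R}} .{{_ : NonZero S}} → a * + S ≡ b * + R → a ℚ./ R ≡ b ℚ./ S
/-cross a b (suc r) (suc s) eq = ℚₚ.fromℚᵘ-cong {mkℚᵘ a r} {mkℚᵘ b s} (*≡* eq)

/-injectiveˡ : ∀ a b R .{{_ : NonZero R}} → a ℚ./ R ≡ b ℚ./ R → a ≡ b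
/-injectiveˡ a b R@(suc _) eq = ℤₚ.*-cancelʳ-≡ a b (+ R) (/-injective a b R R eq)

/≡0⇒ : ∀ a R .{{_ : NonZero R}} → a ℚ./ R ≡ 0ℚ → a ≡ + 0
/≡0⇒ a R eq = trans (sym (ℤₚ.*-identityʳ a)) (/-injective a (+ 0) R 1 eq)

/≡0⇐ : ∀ a R .{{_ : NonZero R}} → a ≡ + 0 → a ℚ./ R ≡ 0ℚ
/≡0⇐ a R eq = /-cross a (+ 0) R 1 (trans (ℤₚ.*-identityʳ a) eq)

/≡1⇒ : ∀ a R .{{_ : NonZero R}} → a ℚ./ R ≡ 1ℚ → a ≡ + R
/≡1⇒ a R eq = trans (sym (ℤₚ.*-identityʳ a)) (trans (/-injective a (+ 1) R 1 eq) (ℤₚ.*-identityˡ (+ R)))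

/≡1⇐ : ∀ a R .{{_ : NonZero R}} → a ≡ + R → a ℚ./ R ≡ 1ℚ
/≡1⇐ a R eq = /-cross a (+ 1) R 1 (trans (ℤₚ.*-identityʳ a) (trans eq (sym (ℤₚ.*-identityˡ (+ R)))))

0</⇒ : ∀ a R .{{_ : NonZero R}} → 0ℚ ℚ.< a ℚ./ R → + 0 < a
0</⇒ a (suc r) p = subst (+ 0 <_) (ℤₚ.*-identityʳ a) (/-<⇒ (+ 0) 0 a r p)

0</⇐ : ∀ a R .{{_ : NonZero R}} → + 0 < a → 0ℚ ℚ.< a ℚ./ R
0</⇐ a (suc r) p = /-<⇐ (+ 0) 0 a r (subst (+ 0 <_) (sym (ℤₚ.*-identityʳ a)) p)

private
  -- The right side is exactly what unnormalised arithmetic computes, with nothing cancelled; the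
  -- surplus factor R · R is removed in `/-det≡1⇒`.
  /-det : ∀ a b c d r → let R = suc r in
          (a ℚ./ R) ℚ.* (d ℚ./ R) ℚ.- (b ℚ./ R) ℚ.* (c ℚ./ R)
            ≡ (a * d * + (R ℕ.* R) + (- (b * c)) * + (R ℕ.* R)) ℚ./ (R ℕ.* R ℕ.* (R ℕ.* R))
  /-det a b c d r = trans (cong₂ ℚ._-_ (fromℚᵘ-* (mkℚᵘ a r) (mkℚᵘ d r)) (fromℚᵘ-* (mkℚᵘ b r) (mkℚᵘ c r)))
    (fromℚᵘ-- (mkℚᵘ a r ℚᵘ.* mkℚᵘ d r) (mkℚᵘ b r ℚᵘ.* mkℚᵘ c r))

  gather : ∀ a b c d s → a * d * s + (- (b * c)) * s ≡ (a * d - b * c) * s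
  gather = solve-∀

/-det≡1⇒ : ∀ a b c d R .{{_ : NonZero R}} →
           (a ℚ./ R) ℚ.* (d ℚ./ R) ℚ.- (b ℚ./ R) ℚ.* (c ℚ./ R) ≡ 1ℚ → a * d - b * c ≡ + R * + R
/-det≡1⇒ a b c d R@(suc r) eq = ℤₚ.*-cancelʳ-≡ _ _ (+ (R ℕ.* R)) (begin
  (a * d - b * c) * + (R ℕ.* R)                         ≡⟨ gather a b c d (+ (R ℕ.* R)) ⟨
  a * d * + (R ℕ.* R) + (- (b * c)) * + (R ℕ.* R)        ≡⟨ /≡1⇒ _ (R ℕ.* R ℕ.* (R ℕ.* R)) (trans (sym (/-det a b c d r)) eq) ⟩
  + (R ℕ.* R ℕ.* (R ℕ.* R))                             ≡⟨ ℤₚ.pos-* (R ℕ.* R) (R ℕ.* R) ⟩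
  + (R ℕ.* R) * + (R ℕ.* R)                             ≡⟨ cong (_* + (R ℕ.* R)) (ℤₚ.pos-* R R) ⟩
  + R * + R * + (R ℕ.* R)                               ∎)
  where open ≡-Reasoning

/-det≡1⇐ : ∀ a b c d R .{{_ : NonZero R}} →
           a * d - b * c ≡ + R * + R → (a ℚ./ R) ℚ.* (d ℚ./ R) ℚ.- (b ℚ./ R) ℚ.* (c ℚ./ R) ≡ 1ℚ
/-det≡1⇐ a b c d R@(suc r) eq = trans (/-det a b c d r) (/≡1⇐ _ (R ℕ.* R ℕ.* (R ℕ.* R)) (begin
  a * d * + (R ℕ.* R) + (- (b * c)) * + (R ℕ.* R)        ≡⟨ gather a b c d (+ (R ℕ.* R)) ⟩
  (a * d - b * c) * + (R ℕ.* R)                         ≡⟨ cong (_* + (R ℕ.* R)) (trans eq (sym (ℤₚ.pos-* R R))) ⟩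
  + (R ℕ.* R) * + (R ℕ.* R)                             ≡⟨ ℤₚ.pos-* (R ℕ.* R) (R ℕ.* R) ⟨
  + (R ℕ.* R ℕ.* (R ℕ.* R))                             ∎))
  where open ≡-Reasoning

scale-/ : ∀ K R .{{_ : NonZero R}} a → scale (K ℕ.* R) (a ℚ./ R) ≡ (+ K * a) ℚ./ 1
scale-/ K R@(suc r) a = trans (fromℚᵘ-* (mkℚᵘ (+ (K ℕ.* R)) 0) (mkℚᵘ a r))
  (/-cross (+ (K ℕ.* R) * a) (+ K * a) (1 ℕ.* R) 1 (begin
    + (K ℕ.* R) * a * + 1      ≡⟨ cong (λ t → t * a * + 1) (ℤₚ.pos-* K R) ⟩
    + K * + R * a * + 1        ≡⟨ h (+ K) (+ R) a ⟩
    + K * a * (+ 1 * + R)      ≡⟨ cong (+ K * a *_) (ℤₚ.pos-* 1 R) ⟨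
    + K * a * + (1 ℕ.* R)      ∎))
  where
  open ≡-Reasoning
  h : ∀ k r a → k * r * a * + 1 ≡ k * a * (+ 1 * r)
  h = solve-∀

scale-injective : ∀ N .{{_ : NonZero N}} p q → scale N p ≡ scale N q → p ≡ q
scale-injective (suc n) p q eq = ℚₚ.≤-antisym (cancel (ℚₚ.≤-reflexive eq)) (cancel (ℚₚ.≤-reflexive (sym eq)))
  where
  instance
    N-pos : ℚ.Positive (+ suc n ℚ./ 1)
    N-pos = ℚₚ.normalize-pos (suc n) 1
  cancel : ∀ {p q} → scale (suc n) p ℚ.≤ scale (suc n) q → p ℚ.≤ q
  cancel = ℚₚ.*-cancelˡ-≤-pos (+ suc n ℚ./ 1)

-- Friezes with integer numerators

inStrip : ∀ {n} i j k → i - j ≡ + k → k ℕ.≤ n → InStrip n i j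
inStrip i j k i-j≡k k≤n = subst (+ 0 ≤_) (sym i-j≡k) (+≤+ z≤n) , subst (_≤ _) (sym i-j≡k) (+≤+ k≤n)

interior : ∀ {n} i j k → i - j ≡ + suc k → suc k ℕ.< n → Interior n i j
interior i j k i-j≡k k<n = subst (+ 0 <_) (sym i-j≡k) (+<+ (s≤s z≤n)) , subst (_< _) (sym i-j≡k) (+<+ k<n)

+-offset : ∀ j k → j + k - j ≡ k
+-offset = solve-∀

strip-offset : ∀ {n} i j → InStrip n i j → ∃ λ k → k ℕ.≤ n × i ≡ j + + k
strip-offset {n} i j (0≤ , ≤n) with ≤⇒offset {i} {j} (ℤₚ.0≤i-j⇒j≤i 0≤)
... | k , refl = k , ℤₚ.drop‿+≤+ (subst (_≤ + n) (+-offset j (+ k)) ≤n) , refl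

interior-offset : ∀ {n} i j → Interior n i j → ∃ λ k → suc k ℕ.< n × i ≡ j + + suc k
interior-offset {n} i j (0< , <n) with ≤⇒offset {i} {j} (ℤₚ.<⇒≤ (0<i-j⇒j<i 0<))
... | zero  , refl = ⊥-elim (ℤₚ.<-irrefl refl (subst (+ 0 <_) (+-offset j (+ 0)) 0<))
... | suc k , refl = k , ℤₚ.drop‿+<+ (subst (_< + n) (+-offset j (+ suc k)) <n) , refl

-- The frieze conditions for z = R m: each 1 on the boundary becomes R, and the diamond rule, being
-- quadratic, acquires R · R.
record IsIntFrieze (R n : ℕ) (z : ℤ → ℤ → ℤ) : Set where
  field
    diag₀    : ∀ i → z i i ≡ + 0
    diagₙ    : ∀ i → z (i + + n) i ≡ + 0
    diag₁    : ∀ i → z (i + + 1) i ≡ + R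
    diagₙ₋₁  : ∀ i → z (i + + n) (i + + 1) ≡ + R
    diamond  : ∀ i j → Interior n i j →
               z i j * z (i + + 1) (j + + 1) - z i (j + + 1) * z (i + + 1) j ≡ + R * + R
    positive : ∀ i j → Interior n i j → + 0 < z i j

module _ (R n : ℕ) .{{_ : NonZero R}} .{{_ : NonZero n}} (m : Array) (z : ℤ → ℤ → ℤ)
         (m≡z/R : ∀ i j → InStrip n i j → m i j ≡ z i j ℚ./ R) where

  private
    n≢0 : 1 ℕ.≤ n
    n≢0 = ℕ.>-nonZero⁻¹ n

    s₀ : ∀ i → InStrip n i i
    s₀ i = inStrip i i 0 (ℤₚ.+-inverseʳ i) z≤n
    sₙ : ∀ i → InStrip n (i + + n) i
    sₙ i = inStrip (i + + n) i n (+-offset i (+ n)) ℕₚ.≤-refl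
    s₁ : ∀ i → InStrip n (i + + 1) i
    s₁ i = inStrip (i + + 1) i 1 (+-offset i (+ 1)) n≢0
    sₙ₋₁ : ∀ i → InStrip n (i + + n) (i + + 1)
    sₙ₋₁ i = inStrip (i + + n) (i + + 1) (ℕ.pred n) (trans (cong (λ t → i + + t - (i + + 1)) (sym (ℕₚ.suc-pred n))) (h i (+ ℕ.pred n))) ℕₚ.pred[n]≤n
      where
      h : ∀ i p → i + (+ 1 + p) - (i + + 1) ≡ p
      h = solve-∀
    cell : ∀ i j → Interior n i j → InStrip n i j
    cell i j (0< , <n) = ℤₚ.<⇒≤ 0< , ℤₚ.<⇒≤ <n
    corner : ∀ i j → Interior n i j → InStrip n (i + + 1) (j + + 1)
    corner i j int = subst (λ t → (+ 0 ≤ t) × (t ≤ + n)) (h i j) (cell i j int)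
      where
      h : ∀ i j → i - j ≡ i + + 1 - (j + + 1)
      h = solve-∀
    -- The neighbours of an interior cell may lie on the boundary but never outside the strip, so m
    -- = z / R applies to all four corners of a diamond.
    right : ∀ i j → Interior n i j → InStrip n i (j + + 1)
    right i j int with interior-offset i j int
    ... | k , 1+k<n , refl = inStrip (j + + suc k) (j + + 1) k (h j (+ k)) (ℕₚ.≤-trans (ℕₚ.n≤1+n k) (ℕₚ.<⇒≤ 1+k<n))
      where
      h : ∀ j k → j + (+ 1 + k) - (j + + 1) ≡ k
      h = solve-∀
    down : ∀ i j → Interior n i j → InStrip n (i + + 1) j
    down i j int with interior-offset i j int
    ... | k , 1+k<n , refl = inStrip (j + + suc k + + 1) j (suc (suc k)) (h j (+ k)) 1+k<n
      where
      h : ∀ j k → j + (+ 1 + k) + + 1 - j ≡ + 2 + k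
      h = solve-∀

    diamond≡ : ∀ i j → Interior n i j →
      m i j ℚ.* m (i + + 1) (j + + 1) ℚ.- m i (j + + 1) ℚ.* m (i + + 1) j
        ≡ (z i j ℚ./ R) ℚ.* (z (i + + 1) (j + + 1) ℚ./ R) ℚ.- (z i (j + + 1) ℚ./ R) ℚ.* (z (i + + 1) j ℚ./ R)
    diamond≡ i j int = cong₂ ℚ._-_ (cong₂ ℚ._*_ (m≡z/R i j (cell i j int)) (m≡z/R (i + + 1) (j + + 1) (corner i j int)))
                                   (cong₂ ℚ._*_ (m≡z/R i (j + + 1) (right i j int)) (m≡z/R (i + + 1) j (down i j int)))

  frieze⇒intFrieze : IsFrieze n m → IsPositive n m → IsIntFrieze R n z
  frieze⇒intFrieze F pos = record
    { diag₀    = λ i → /≡0⇒ _ R (trans (sym (m≡z/R i i (s₀ i))) (diag₀ i))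
    ; diagₙ    = λ i → /≡0⇒ _ R (trans (sym (m≡z/R (i + + n) i (sₙ i))) (diagₙ i))
    ; diag₁    = λ i → /≡1⇒ _ R (trans (sym (m≡z/R (i + + 1) i (s₁ i))) (diag₁ i))
    ; diagₙ₋₁  = λ i → /≡1⇒ _ R (trans (sym (m≡z/R (i + + n) (i + + 1) (sₙ₋₁ i))) (diagₙ₋₁ i))
    ; diamond  = λ i j int → /-det≡1⇒ (z i j) (z i (j + + 1)) (z (i + + 1) j) (z (i + + 1) (j + + 1)) R
                   (trans (sym (diamond≡ i j int)) (diamond i j int))
    ; positive = λ i j int → 0</⇒ _ R (subst (0ℚ ℚ.<_) (m≡z/R i j (cell i j int)) (pos i j int))
    }
    where open IsFrieze F

  intFrieze⇒frieze : IsIntFrieze R n z → IsFrieze n m × IsPositive n m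
  intFrieze⇒frieze F = record
    { diag₀   = λ i → trans (m≡z/R i i (s₀ i)) (/≡0⇐ _ R (diag₀ i))
    ; diagₙ   = λ i → trans (m≡z/R (i + + n) i (sₙ i)) (/≡0⇐ _ R (diagₙ i))
    ; diag₁   = λ i → trans (m≡z/R (i + + 1) i (s₁ i)) (/≡1⇐ _ R (diag₁ i))
    ; diagₙ₋₁ = λ i → trans (m≡z/R (i + + n) (i + + 1) (sₙ₋₁ i)) (/≡1⇐ _ R (diagₙ₋₁ i))
    ; diamond = λ i j int → trans (diamond≡ i j int)
                  (/-det≡1⇐ (z i j) (z i (j + + 1)) (z (i + + 1) j) (z (i + + 1) (j + + 1)) R (diamond i j int))
    } , λ i j int → subst (0ℚ ℚ.<_) (sym (m≡z/R i j (cell i j int))) (0</⇐ _ R (positive i j int))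
    where open IsIntFrieze F

-- Antiperiodic sequences, and the frieze of a closed path.

Antiperiodic : ℕ → (ℤ → Vec2) → Set
Antiperiodic n v = ∀ i → v (i + + n) ≡ neg (v i)

swap-shift : ∀ i k n → i + n + k ≡ i + k + n
swap-shift = solve-∀

module _ {n : ℕ} {v : ℤ → Vec2} (anti : Antiperiodic n v) where

  det-shift : ∀ i k → det (v (i + + n)) (v (i + + n + k)) ≡ det (v i) (v (i + k))
  det-shift i k = trans (cong₂ det (anti i) (trans (cong v (swap-shift i k (+ n))) (anti (i + k)))) (det-neg (v i) (v (i + k)))

  -- The sign from antiperiodicity cancels the sign from skew symmetry. This is the glide symmetry
  -- of the frieze.
  det-wrap : ∀ i j → det (v i) (v (j + + n)) ≡ det (v j) (v i)
  det-wrap i j = trans (cong (det (v i)) (anti j)) (trans (det-negʳ (v i) (v j)) (sym (det-swap (v j) (v i))))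

module Path (R n : ℕ) .{{_ : NonZero R}} .{{_ : NonZero n}} (v : ℤ → Vec2) (path : ClosedCWPath R n v) where
  open ClosedCWPath path

  edge : ∀ i → det (v i) (v (i + + 1)) ≡ + R
  edge = periodic-induction n _
    (λ j e → trans (det-shift antiperiodic j (+ 1)) e)
    (λ j e → trans (sym (det-shift antiperiodic j (+ 1))) e)
    -- `edges` is indexed by the endpoint, from 1 to n, so the edge leaving v_r is its instance at r
    -- + 1.
    λ r r<n → trans (cong (λ t → det (v (+ r)) (v (+ t))) (ℕₚ.+-comm r 1))
                (edges (+ suc r) (+≤+ (s≤s z≤n)) (+≤+ r<n))

  private
    nonZero : ∀ r → r ℕ.< n → NonZeroVec (v (+ r))
    nonZero r r<n = proj₁ (vertices (+ r) (+≤+ z≤n , +≤+ (ℕₚ.<⇒≤ r<n)))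

    0<R : + 0 < + R
    0<R = +<+ (ℕ.>-nonZero⁻¹ R)

    -- Induction on the distance. With i = j + k + 1 in the successor case, the clockwise order
    -- makes the orientation of v_j, v_i, v_{i+1} positive. Of its factors, det(v_j,v_i) is positive
    -- by induction and det(v_i,v_{i+1}) is R, so the third is positive too.
    positive₀ : ∀ j k → j ℕ.+ suc k ℕ.< n → + 0 < det (v (+ j)) (v (+ (j ℕ.+ suc k)))
    positive₀ j zero    j+1<n = subst (+ 0 <_) (sym (edge (+ j))) 0<R
    positive₀ j (suc k) j+2+k<n =
      *-cancel-pos (det (v (+ j)) (v (+ i)) * det (v (+ i)) (v (+ (j ℕ.+ suc (suc k)))))
        (*-pos prev next)
        (clockwise⇒orientation (v (+ j)) (v (+ i)) (v (+ (j ℕ.+ suc (suc k))))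
          (nonZero j j<n) (nonZero i i<n) (nonZero _ j+2+k<n)
          (clockwise (+ j) (+ i) (+ (j ℕ.+ suc (suc k))) (+≤+ z≤n) (+<+ (ℕₚ.m<m+n j (s≤s z≤n)))
            (+<+ i<) (+<+ j+2+k<n)))
      where
      i = j ℕ.+ suc k
      1+i≡ : j ℕ.+ suc (suc k) ≡ i ℕ.+ 1
      1+i≡ = trans (ℕₚ.+-suc j (suc k)) (ℕₚ.+-comm 1 i)
      i< : i ℕ.< j ℕ.+ suc (suc k)
      i< = ℕₚ.+-monoʳ-< j (ℕₚ.n<1+n (suc k))
      i<n : i ℕ.< n
      i<n = ℕₚ.<-trans i< j+2+k<n
      j<n : j ℕ.< n
      j<n = ℕₚ.≤-<-trans (ℕₚ.m≤m+n j (suc k)) i<n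
      prev : + 0 < det (v (+ j)) (v (+ i))
      prev = positive₀ j k i<n
      next : + 0 < det (v (+ i)) (v (+ (j ℕ.+ suc (suc k))))
      next = subst (+ 0 <_) (sym (trans (cong (λ t → det (v (+ i)) (v (+ t))) 1+i≡) (edge (+ i)))) 0<R

  positive : ∀ j k → suc k ℕ.< n → + 0 < det (v j) (v (j + + suc k))
  positive = periodic-induction n _
    (λ j p k k<n → subst (+ 0 <_) (sym (det-shift antiperiodic j (+ suc k))) (p k k<n))
    (λ j p k k<n → subst (+ 0 <_) (det-shift antiperiodic j (+ suc k)) (p k k<n))
    base
    where
    base : ∀ r → r ℕ.< n → ∀ k → suc k ℕ.< n → + 0 < det (v (+ r)) (v (+ r + + suc k))
    base r r<n k k<n with r ℕ.+ suc k ℕₚ.<? n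
    ... | yes inside = positive₀ r k inside
    -- Past the end of the period the index is n + s with s < r, and `det-wrap` leads back to v_s
    -- and v_r, both inside the period.
    ... | no outside with ℕₚ.m≤n⇒∃[o]m+o≡n (ℕₚ.≮⇒≥ outside)
    ... | s , n+s≡ = subst (+ 0 <_) wrap (positive′ (ℕₚ.m≤n⇒∃[o]m+o≡n s<r))
      where
      s<r : suc s ℕ.≤ r
      s<r = ℕₚ.+-cancelˡ-< n s r (subst₂ ℕ._<_ (sym n+s≡) (ℕₚ.+-comm r n) (ℕₚ.+-monoʳ-< r k<n))
      wrap : det (v (+ s)) (v (+ r)) ≡ det (v (+ r)) (v (+ r + + suc k))
      wrap = trans (sym (det-wrap antiperiodic (+ r) (+ s)))
               (cong (λ t → det (v (+ r)) (v (+ t))) (trans (ℕₚ.+-comm s n) n+s≡))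
      positive′ : ∃ (λ l → suc s ℕ.+ l ≡ r) → + 0 < det (v (+ s)) (v (+ r))
      positive′ (l , refl) = subst (λ t → + 0 < det (v (+ s)) (v (+ t))) (ℕₚ.+-suc s l)
        (positive₀ s l (subst (ℕ._< n) (sym (ℕₚ.+-suc s l)) r<n))

  isIntFrieze : IsIntFrieze R n (λ i j → det (v j) (v i))
  isIntFrieze = record
    { diag₀    = λ i → det-self (v i)
    ; diagₙ    = λ i → trans (det-wrap antiperiodic i i) (det-self (v i))
    ; diag₁    = edge
    ; diagₙ₋₁  = λ i → trans (det-wrap antiperiodic (i + + 1) i) (edge i)
    ; diamond  = λ i j _ → trans (plücker (v j) (v i) (v (j + + 1)) (v (i + + 1))) (cong₂ _*_ (edge j) (edge i))
    ; positive = λ i j int → pos i j (interior-offset i j int)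
    }
    where
    pos : ∀ i j → ∃ (λ k → suc k ℕ.< n × i ≡ j + + suc k) → + 0 < det (v j) (v i)
    pos _ j (k , k<n , refl) = positive j k k<n

-- Greatest common divisors and orbits

-- The witness is d / gcd(d , k).
cofactor : ∀ d k .{{_ : ℤ.NonZero k}} → ∃ λ q → (∀ x → d ∣ k * x → q ∣ x) × (q ∣ + 1 → d ∣ k)
cofactor d k with bézout d k
... | g , divides q d≡qg , divides r k≡rg , x , y , g≡ = q , divide , complete
  where
  instance
    g≢0 : ℤ.NonZero g
    g≢0 = ℤ.≢-nonZero {g} λ { refl → ℕ.≢-nonZero⁻¹ ℤ.∣ k ∣ (cong ℤ.∣_∣ (trans k≡rg (ℤₚ.*-zeroʳ r))) }
  h : ∀ x y q r g → x * (q * g) + y * (r * g) ≡ (x * q + y * r) * g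
  h = solve-∀
  1≡ : + 1 ≡ x * q + y * r
  1≡ = ℤₚ.*-cancelʳ-≡ _ _ g (trans (ℤₚ.*-identityˡ g)
         (trans (trans g≡ (cong₂ (λ s t → x * s + y * t) d≡qg k≡rg)) (h x y q r g)))
  divide : ∀ z → d ∣ k * z → q ∣ z
  divide z (divides c kz≡cd) = divides (x * z + y * c) (begin
    z                           ≡⟨ ℤₚ.*-identityˡ z ⟨
    + 1 * z                     ≡⟨ cong (_* z) 1≡ ⟩
    (x * q + y * r) * z         ≡⟨ h₁ x y q r z ⟩
    x * q * z + y * (r * z)     ≡⟨ cong (λ t → x * q * z + y * t) rz≡cq ⟩
    x * q * z + y * (c * q)     ≡⟨ h₂ x y q c z ⟩
    (x * z + y * c) * q         ∎)
    where
    open ≡-Reasoning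
    h₀ : ∀ r g z → r * z * g ≡ r * g * z
    h₀ = solve-∀
    h₁ : ∀ x y q r z → (x * q + y * r) * z ≡ x * q * z + y * (r * z)
    h₁ = solve-∀
    h₂ : ∀ x y q c z → x * q * z + y * (c * q) ≡ (x * z + y * c) * q
    h₂ = solve-∀
    rz≡cq : r * z ≡ c * q
    rz≡cq = ℤₚ.*-cancelʳ-≡ _ _ g (trans (h₀ r g z) (trans (cong (_* z) (sym k≡rg))
              (trans kz≡cd (trans (cong (c *_) d≡qg) (sym (ℤₚ.*-assoc c q g))))))
  complete : q ∣ + 1 → d ∣ k
  complete (divides t 1≡tq) = divides (r * t) (begin
    k                ≡⟨ k≡rg ⟩
    r * g            ≡⟨ cong (r *_) (ℤₚ.*-identityˡ g) ⟨
    r * (+ 1 * g)    ≡⟨ cong (λ s → r * (s * g)) 1≡tq ⟩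
    r * (t * q * g)  ≡⟨ h₃ r t q g ⟩
    r * t * (q * g)  ≡⟨ cong (r * t *_) d≡qg ⟨
    r * t * d        ∎)
    where
    open ≡-Reasoning
    h₃ : ∀ r t q g → r * (t * q * g) ≡ r * t * (q * g)
    h₃ = solve-∀

∣-swap : ∀ {d} u w → d ∣ det u w → d ∣ det w u
∣-swap u w d∣ = subst (_ ∣_) (sym (det-swap w u)) (∣m⇒∣-m d∣)

module _ {n : ℕ} .{{_ : NonZero n}} {v : ℤ → Vec2} (anti : Antiperiodic n v) where

  -- Minimality looks at the indices 0, ..., n, the gcd of a frieze at the whole strip. Moving one
  -- index by n only changes the sign of a determinant, so the two indices are extended one after
  -- the other.
  ∣det-all : ∀ {d} → (∀ i j → i ℕ.< n → j ℕ.< n → d ∣ det (v (+ j)) (v (+ i))) → ∀ i j → d ∣ det (v j) (v i)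
  ∣det-all {d} base i j = extend (v j) (λ r r<n → ∣-swap (v (+ r)) (v j) (extend (v (+ r)) (λ s s<n → base s r s<n r<n) j)) i
    where
    extend : ∀ u → (∀ r → r ℕ.< n → d ∣ det u (v (+ r))) → ∀ i → d ∣ det u (v i)
    extend u base = periodic-induction n _
      (λ i d∣ → subst (d ∣_) (sym (trans (cong (det u) (anti i)) (det-negʳ u (v i)))) (∣m⇒∣-m d∣))
      (λ i d∣ → subst (d ∣_) (trans (cong -_ (trans (cong (det u) (anti i)) (det-negʳ u (v i)))) (ℤₚ.neg-involutive _)) (∣m⇒∣-m d∣))
      base

∣ℚ-intro : ∀ {d q a} k → q ≡ a ℚ./ 1 → a ≡ k * d → d ∣ℚ q
∣ℚ-intro k q≡a/1 a≡kd = k , trans q≡a/1 (cong (ℚ._/ 1) a≡kd)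

inRange : ∀ {n} r → r ℕ.≤ n → InRange n (+ r)
inRange r r≤n = +≤+ z≤n , +≤+ r≤n

module _ (K R n : ℕ) .{{_ : NonZero K}} .{{_ : NonZero R}} .{{_ : NonZero n}}
         (v : ℤ → Vec2) (path : ClosedCWPath R n v) where

  private
    m = friezeOf R v
    scaled : ∀ i j → scale (K ℕ.* R) (m i j) ≡ (+ K * det (v j) (v i)) ℚ./ 1
    scaled i j = scale-/ K R (det (v j) (v i))

    instance
      K≢0 : ℤ.NonZero (+ K)
      K≢0 = ℤ.≢-nonZero λ K≡0 → ℕ.≢-nonZero⁻¹ K (ℤₚ.+-injective K≡0)

  -- N m(i,j) = K det(v_j,v_i). If d divides all of these, then q = d / gcd(d,K) divides all the
  -- determinants, so q is a unit by minimality and d divides K.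
  minimal⇒GCDIs : Minimal n v → GCDIs (K ℕ.* R) n K m
  minimal⇒GCDIs minimal =
    (λ i j _ → ∣ℚ-intro (det (v j) (v i)) (scaled i j) (ℤₚ.*-comm (+ K) (det (v j) (v i)))) ,
    λ d d∣m → greatest d d∣m (cofactor d (+ K))
    where
    greatest : ∀ d → (∀ i j → InStrip n i j → d ∣ℚ scale (K ℕ.* R) (m i j)) →
               (∃ λ q → (∀ x → d ∣ + K * x → q ∣ x) × (q ∣ + 1 → d ∣ + K)) → _
    greatest d d∣m (q , divide , complete) = ∣⇒∣ᵤ (complete (∣ᵤ⇒∣ (minimal q λ i j i∈ j∈ → ∣⇒∣ᵤ (q∣det i j i∈ j∈))))
      where
      q∣ : ∀ i j → InStrip n i j → q ∣ det (v j) (v i)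
      q∣ i j strip with d∣m i j strip
      ... | k , eq = divide _ (divides k (/-injectiveˡ (+ K * det (v j) (v i)) (k * d) 1 (trans (sym (scaled i j)) eq)))
      below : ∀ i j → + 0 ≤ j → j ≤ i → i ≤ + n → InStrip n i j
      below i j 0≤j j≤i i≤n = ℤₚ.i≤j⇒0≤j-i j≤i , ℤₚ.≤-trans (ℤₚ.+-monoʳ-≤ i (ℤₚ.neg-mono-≤ 0≤j)) (subst (_≤ + n) (sym (ℤₚ.+-identityʳ i)) i≤n)
      q∣det : ∀ i j → InRange n i → InRange n j → q ∣ det (v j) (v i)
      q∣det i j (0≤i , i≤n) (0≤j , j≤n) with ℤₚ.≤-total j i
      ... | inj₁ j≤i = q∣ i j (below i j 0≤j j≤i i≤n)
      ... | inj₂ i≤j = ∣-swap (v i) (v j) (q∣ j i (below j i 0≤i i≤j j≤n))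

  minimalPath⇒frieze : Minimal n v → PositiveFriezeGCD (K ℕ.* R) n K m
  minimalPath⇒frieze minimal = proj₁ friezeProps , proj₂ friezeProps ,
    (λ i j _ → ∣ℚ-intro (+ K * det (v j) (v i)) (scaled i j) (sym (ℤₚ.*-identityʳ (+ K * det (v j) (v i))))) ,
    minimal⇒GCDIs minimal
    where
    friezeProps : IsFrieze n m × IsPositive n m
    friezeProps = intFrieze⇒frieze R n m (λ i j → det (v j) (v i)) (λ _ _ _ → refl) (Path.isIntFrieze R n v path)

  -- If d divides all determinants, then K d divides all entries of N m′, hence K d divides K. The
  -- array `m′` need only agree with the frieze of v on the strip, as in `realise`.
  GCDIs⇒minimal : ∀ m′ → m ≈[ n ] m′ → GCDIs (K ℕ.* R) n K m′ → Minimal n v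
  GCDIs⇒minimal m′ m≈m′ (_ , greatest) d d∣ = ∣⇒∣ᵤ (cancel (∣ᵤ⇒∣ (greatest (+ K * d) Kd∣)))
    where
    cancel : + K * d ∣ + K → d ∣ + 1
    cancel (divides t eq) = divides t (ℤₚ.*-cancelˡ-≡ (+ K) (+ 1) (t * d) (trans (ℤₚ.*-identityʳ (+ K)) (trans eq (h (+ K) t d))))
      where
      h : ∀ k t d → t * (k * d) ≡ k * (t * d)
      h = solve-∀
    Kd∣ : ∀ i j → InStrip n i j → (+ K * d) ∣ℚ scale (K ℕ.* R) (m′ i j)
    Kd∣ i j strip = lift (∣det-all (ClosedCWPath.antiperiodic path)
        (λ i j i<n j<n → ∣ᵤ⇒∣ (d∣ (+ i) (+ j) (inRange i (ℕₚ.<⇒≤ i<n)) (inRange j (ℕₚ.<⇒≤ j<n)))) i j)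
      where
      h : ∀ k t d → k * (t * d) ≡ t * (k * d)
      h = solve-∀
      lift : d ∣ det (v j) (v i) → (+ K * d) ∣ℚ scale (K ℕ.* R) (m′ i j)
      lift (divides t eq) = ∣ℚ-intro t (trans (cong (scale (K ℕ.* R)) (sym (m≈m′ i j strip))) (scaled i j))
                              (trans (cong (+ K *_) eq) (h (+ K) t d))

-- The multipliers d that turn the sequence f into an integral linear form in v. They form an ideal;
-- once it contains a unit, f itself is such a form, that is, (α , β) becomes a row of the matrix
-- sought.
Rowwise : (ℤ → Vec2) → (ℤ → ℤ) → ℤ → Set
Rowwise v f d = ∃ λ α → ∃ λ β → ∀ k → d * f k ≡ α * proj₁ (v k) + β * proj₂ (v k)

rowwise-ideal : ∀ v f → IsIdeal (Rowwise v f)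
rowwise-ideal v f = record
  { has0 = + 0 , + 0 , λ k → h₀ (f k) (proj₁ (v k)) (proj₂ (v k))
  ; comb = λ x y {a} {b} (α , β , p) (γ , δ , q) → x * α + y * γ , x * β + y * δ , λ k →
      trans (h₁ x y a b (f k)) (trans (cong₂ (λ s t → x * s + y * t) (p k) (q k))
        (h₂ x y α β γ δ (proj₁ (v k)) (proj₂ (v k))))
  }
  where
  h₀ : ∀ f a b → + 0 * f ≡ + 0 * a + + 0 * b
  h₀ = solve-∀
  h₁ : ∀ x y a b f → (x * a + y * b) * f ≡ x * (a * f) + y * (b * f)
  h₁ = solve-∀
  h₂ : ∀ x y α β γ δ a b → x * (α * a + β * b) + y * (γ * a + δ * b) ≡ (x * α + y * γ) * a + (x * β + y * δ) * b
  h₂ = solve-∀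

cramer : ∀ s t u → (det s t * proj₁ u ≡ det u t * proj₁ s + det s u * proj₁ t)
                 × (det s t * proj₂ u ≡ det u t * proj₂ s + det s u * proj₂ t)
cramer (a , b) (c , d) (e , f) = h₁ a b c d e f , h₂ a b c d e f
  where
  h₁ : ∀ a b c d e f → (a * d - b * c) * e ≡ (e * d - f * c) * a + (a * f - b * e) * c
  h₁ = solve-∀
  h₂ : ∀ a b c d e f → (a * d - b * c) * f ≡ (e * d - f * c) * b + (a * f - b * e) * d
  h₂ = solve-∀

private
  expand : ∀ s t u x y → det u t * x + det s u * y
             ≡ (proj₂ t * x - proj₂ s * y) * proj₁ u + (proj₁ s * y - proj₁ t * x) * proj₂ u
  expand (a , b) (c , d) (e , f) x y = h a b c d e f x y
    where
    h : ∀ a b c d e f x y → (e * d - f * c) * x + (a * f - b * e) * y ≡ (d * x - b * y) * e + (a * y - c * x) * f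
    h = solve-∀

module _ (n : ℕ) (v w : ℤ → Vec2)
         (same : ∀ i j → det (v j) (v i) ≡ det (w j) (w i)) where

  private
    -- Cramer's rule writes det(w_j,w_i) w_k through determinants that involve w_k. These equal the
    -- corresponding determinants for v, which are linear in v_k. Here `f` is one of the two
    -- coordinates.
    rowwise-det : (f : Vec2 → ℤ) → (∀ s t u → det s t * f u ≡ det u t * f s + det s u * f t) →
                  ∀ i j → Rowwise v (λ k → f (w k)) (det (v j) (v i))
    rowwise-det f cram i j =
      proj₂ (v i) * f (w j) - proj₂ (v j) * f (w i) , proj₁ (v j) * f (w i) - proj₁ (v i) * f (w j) , λ k → begin
      det (v j) (v i) * f (w k)                                          ≡⟨ cong (_* f (w k)) (same i j) ⟩
      det (w j) (w i) * f (w k)                                          ≡⟨ cram (w j) (w i) (w k) ⟩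
      det (w k) (w i) * f (w j) + det (w j) (w k) * f (w i)              ≡⟨ cong₂ (λ s t → s * f (w j) + t * f (w i)) (same i k) (same k j) ⟨
      det (v k) (v i) * f (w j) + det (v j) (v k) * f (w i)              ≡⟨ expand (v j) (v i) (v k) (f (w j)) (f (w i)) ⟩
      (proj₂ (v i) * f (w j) - proj₂ (v j) * f (w i)) * proj₁ (v k)
        + (proj₁ (v j) * f (w i) - proj₁ (v i) * f (w j)) * proj₂ (v k)  ∎
      where open ≡-Reasoning

    Functional : (Vec2 → ℤ) → Set
    Functional f = ∃ λ α → ∃ λ β → ∀ k → f (w k) ≡ α * proj₁ (v k) + β * proj₂ (v k)

    divide-unit : ∀ f g → Rowwise v (λ k → f (w k)) g → g ∣ + 1 → Functional f
    divide-unit f g (α , β , row) (divides t 1≡tg) = t * α , t * β , λ k → begin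
      f (w k)                                            ≡⟨ ℤₚ.*-identityˡ (f (w k)) ⟨
      + 1 * f (w k)                                      ≡⟨ cong (_* f (w k)) 1≡tg ⟩
      t * g * f (w k)                                    ≡⟨ ℤₚ.*-assoc t g (f (w k)) ⟩
      t * (g * f (w k))                                  ≡⟨ cong (t *_) (row k) ⟩
      t * (α * proj₁ (v k) + β * proj₂ (v k))            ≡⟨ h t α β (proj₁ (v k)) (proj₂ (v k)) ⟩
      t * α * proj₁ (v k) + t * β * proj₂ (v k)          ∎
      where
      open ≡-Reasoning
      h : ∀ t α β a b → t * (α * a + β * b) ≡ t * α * a + t * β * b
      h = solve-∀

    module _ (f : Vec2 → ℤ) (cram : ∀ s t u → det s t * f u ≡ det u t * f s + det s u * f t) where

      Divides : ℕ → ℤ → Set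
      Divides i g = ∀ j → j ℕ.< suc n → g ∣ det (v (+ j)) (v (+ i))

      divisor : ∃ λ g → Rowwise v (λ k → f (w k)) g × (∀ i → i ℕ.< suc n → Divides i g)
      -- The inner call runs over j for a fixed i, the outer one over i. Both have n + 1 indices,
      -- since `InRange` includes n.
      divisor = commonDivisor ideal Divides (λ i h∣g g∣ j j≤n → ∣-trans h∣g (g∣ j j≤n)) (suc n)
        λ i _ → commonDivisor ideal (λ j g → g ∣ det (v (+ j)) (v (+ i))) (λ j → ∣-trans) (suc n)
          λ j _ → det (v (+ j)) (v (+ i)) , rowwise-det f cram (+ i) (+ j) , divides (+ 1) (sym (ℤₚ.*-identityˡ _))
        where
        ideal : IsIdeal (Rowwise v (λ k → f (w k)))
        ideal = rowwise-ideal v (λ k → f (w k))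

      functional : Minimal n v → Functional f
      functional minimal = divide-unit f g (proj₁ (proj₂ divisor)) (∣ᵤ⇒∣ (minimal g g∣))
        where
        g = proj₁ divisor
        g∣ : ∀ i j → InRange n i → InRange n j → _
        g∣ (+ i) (+ j) (_ , +≤+ i≤n) (_ , +≤+ j≤n) = ∣⇒∣ᵤ (proj₂ (proj₂ divisor) i (s≤s i≤n) j (s≤s j≤n))

    -- The matrix with these rows multiplies det(v_j,v_i) by its determinant, yet the result
    -- det(w_j,w_i) is the same nonzero number; so the determinant is 1.
    orbit : ∀ i j .{{_ : ℤ.NonZero (det (v j) (v i))}} → Functional proj₁ → Functional proj₂ → SameOrbit v w
    orbit i j (α , β , row₁) (γ , δ , row₂) =
      mat α β γ δ (ℤₚ.*-cancelʳ-≡ (α * δ - β * γ) (+ 1) (det (v j) (v i)) unimodular) , λ k → cong₂ _,_ (row₁ k) (row₂ k)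
      where
      h : ∀ α β γ δ a b c d → (α * δ - β * γ) * (a * d - b * c)
            ≡ (α * a + β * b) * (γ * c + δ * d) - (γ * a + δ * b) * (α * c + β * d)
      h = solve-∀
      unimodular : (α * δ - β * γ) * det (v j) (v i) ≡ + 1 * det (v j) (v i)
      unimodular = begin
        (α * δ - β * γ) * det (v j) (v i)    ≡⟨ h α β γ δ (proj₁ (v j)) (proj₂ (v j)) (proj₁ (v i)) (proj₂ (v i)) ⟩
        (α * proj₁ (v j) + β * proj₂ (v j)) * (γ * proj₁ (v i) + δ * proj₂ (v i))
          - (γ * proj₁ (v j) + δ * proj₂ (v j)) * (α * proj₁ (v i) + β * proj₂ (v i))
                                             ≡⟨ cong₂ _-_ (cong₂ _*_ (row₁ j) (row₂ i)) (cong₂ _*_ (row₂ j) (row₁ i)) ⟨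
        det (w j) (w i)                      ≡⟨ same i j ⟨
        det (v j) (v i)                      ≡⟨ ℤₚ.*-identityˡ _ ⟨
        + 1 * det (v j) (v i)                ∎
        where open ≡-Reasoning

  sameDet⇒sameOrbit : Minimal n v → ∀ i j .{{_ : ℤ.NonZero (det (v j) (v i))}} → SameOrbit v w
  sameDet⇒sameOrbit minimal i j = orbit i j
    (functional proj₁ (λ s t u → proj₁ (cramer s t u)) minimal)
    (functional proj₂ (λ s t u → proj₂ (cramer s t u)) minimal)

module _ (R n : ℕ) .{{_ : NonZero R}} .{{_ : NonZero n}} (v w : ℤ → Vec2)
         (pathᵛ : ClosedCWPath R n v) (pathʷ : ClosedCWPath R n w) where

  private
    module V = ClosedCWPath pathᵛ
    module W = ClosedCWPath pathʷ

    det-up : ∀ {u} → Antiperiodic n u → ∀ j t → det (u j) (u (j + (t + + n))) ≡ - det (u j) (u (j + t))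
    det-up {u} anti j t = trans (cong (λ s → det (u j) (u s)) (sym (ℤₚ.+-assoc j t (+ n))))
                            (trans (cong (det (u j)) (anti (j + t))) (det-negʳ (u j) (u (j + t))))

  -- The friezes compare determinants only at offsets 0, ..., n. Adding n to the offset negates both
  -- sides, which gives all other offsets.
  sameFrieze⇒sameDet : friezeOf R v ≈[ n ] friezeOf R w → ∀ i j → det (v j) (v i) ≡ det (w j) (w i)
  sameFrieze⇒sameDet same i j =
    subst (λ t → det (v j) (v t) ≡ det (w j) (w t)) (h i j)
      (periodic-induction n (λ t → det (v j) (v (j + t)) ≡ det (w j) (w (j + t)))
        (λ t e → trans (det-up V.antiperiodic j t) (trans (cong -_ e) (sym (det-up W.antiperiodic j t))))
        (λ t e → ℤₚ.neg-injective (trans (sym (det-up V.antiperiodic j t)) (trans e (det-up W.antiperiodic j t))))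
        (λ r r<n → /-injectiveˡ _ _ R (same (j + + r) j (inStrip (j + + r) j r (+-offset j (+ r)) (ℕₚ.<⇒≤ r<n))))
        (i - j))
    where
    h : ∀ i j → j + (i - j) ≡ i
    h = solve-∀

  sameFrieze⇒sameOrbit : Minimal n v → friezeOf R v ≈[ n ] friezeOf R w → SameOrbit v w
  sameFrieze⇒sameOrbit minimal same = sameDet⇒sameOrbit n v w (sameFrieze⇒sameDet same) minimal
    -- The edge from v_0 to v_1 supplies the nonzero determinant R.
    (+ 0 + + 1) (+ 0) {{subst ℤ.NonZero (sym (Path.edge R n v pathᵛ (+ 0))) (ℤ.≢-nonZero λ R≡0 → ℕ.≢-nonZero⁻¹ R (ℤₚ.+-injective R≡0))}}

-- Realisation of friezes by paths

-- An integral frieze seen from a chosen origin; natural indices make the inductions on distance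
-- structural.
record IsGrid (R n : ℕ) (F : ℕ → ℕ → ℤ) : Set where
  field
    diag₀    : ∀ i → F i i ≡ + 0
    diagₙ    : ∀ i → F (n ℕ.+ i) i ≡ + 0
    diag₁    : ∀ i → F (suc i) i ≡ + R
    diagₙ₋₁  : ∀ i → F (n ℕ.+ i) (suc i) ≡ + R
    diamond  : ∀ i j → j ℕ.< i → i ℕ.< n ℕ.+ j →
               F i j * F (suc i) (suc j) - F i (suc j) * F (suc i) j ≡ + R * + R
    positive : ∀ i j → j ℕ.< i → i ℕ.< n ℕ.+ j → + 0 < F i j

-- If two adjacent rows (a a′), (b b′), (c c′) of 2×2 minors agree, then (a + c) / b = (a′ + c′) / b′.
minors-proportional : ∀ a b c a′ b′ c′ s → a * b′ - a′ * b ≡ s → b * c′ - b′ * c ≡ s → b′ * (c + a) ≡ b * (c′ + a′)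
minors-proportional a b c a′ b′ c′ s p q = begin
  b′ * (c + a)                                          ≡⟨ h a b c a′ b′ c′ ⟩
  b * (c′ + a′) + ((a * b′ - a′ * b) - (b * c′ - b′ * c)) ≡⟨ cong₂ (λ x y → b * (c′ + a′) + (x - y)) p q ⟩
  b * (c′ + a′) + (s - s)                               ≡⟨ h′ (b * (c′ + a′)) s ⟩
  b * (c′ + a′)                                         ∎
  where
  open ≡-Reasoning
  h : ∀ a b c a′ b′ c′ → b′ * (c + a) ≡ b * (c′ + a′) + ((a * b′ - a′ * b) - (b * c′ - b′ * c))
  h = solve-∀
  h′ : ∀ x s → x + (s - s) ≡ x
  h′ = solve-∀

-- In fractions: x / b = x′ / b′ and x′ / b′ = l / r give x / b = l / r. Only the middle denominator
-- has to be cancelled.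
transfer : ∀ r l b b′ x x′ .{{_ : ℤ.NonZero b′}} → b′ * x ≡ b * x′ → r * x′ ≡ l * b′ → r * x ≡ l * b
transfer r l b b′ x x′ p q = ℤₚ.*-cancelˡ-≡ b′ (r * x) (l * b) (begin
  b′ * (r * x)   ≡⟨ h₁ b′ r x ⟩
  r * (b′ * x)   ≡⟨ cong (r *_) p ⟩
  r * (b * x′)   ≡⟨ h₁ r b x′ ⟩
  b * (r * x′)   ≡⟨ cong (b *_) q ⟩
  b * (l * b′)   ≡⟨ h₂ b l b′ ⟩
  b′ * (l * b)   ∎)
  where
  open ≡-Reasoning
  h₁ : ∀ x y z → x * (y * z) ≡ y * (x * z)
  h₁ = solve-∀
  h₂ : ∀ x y z → x * (y * z) ≡ z * (y * x)
  h₂ = solve-∀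

next : ∀ r l x₀ x₁ x₂ → r * (x₂ + x₀) ≡ l * x₁ → r * x₂ ≡ l * x₁ - r * x₀
next r l x₀ x₁ x₂ p = trans (h r x₀ x₂) (cong (_- r * x₀) p)
  where
  h : ∀ r x₀ x₂ → r * x₂ ≡ r * (x₂ + x₀) - r * x₀
  h = solve-∀

module Grid (R n : ℕ) .{{_ : NonZero R}} (F : ℕ → ℕ → ℤ) (G : IsGrid R n F) where
  open IsGrid G

  private
    instance
      R≢0 : ℤ.NonZero (+ R)
      R≢0 = ℤ.≢-nonZero λ R≡0 → ℕ.≢-nonZero⁻¹ R (ℤₚ.+-injective R≡0)

    start : ∀ {x} y → x ≡ + 0 → + R * (y + x) ≡ y * + R
    start y refl = trans (cong (+ R *_) (ℤₚ.+-identityʳ y)) (ℤₚ.*-comm (+ R) y)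

  -- All adjacent minors equal R · R, so (F(k+2,j) + F(k,j)) / F(k+1,j) is the same for neighbouring
  -- columns. Moving right to j = k, where F(k,k) = 0 and F(k+1,k) = R, gives its value. Positivity
  -- keeps the denominators nonzero.
  rowRecurrence : ∀ d j k → d ℕ.+ j ≡ k → 2 ℕ.+ d ℕ.≤ n →
                  + R * (F (2 ℕ.+ k) j + F k j) ≡ F (2 ℕ.+ k) k * F (suc k) j
  rowRecurrence zero    j k refl _ = trans (start (F (2 ℕ.+ k) k) (diag₀ k)) (cong (F (2 ℕ.+ k) k *_) (sym (diag₁ k)))
  rowRecurrence (suc d) j k refl 3+d≤n =
    transfer (+ R) (F (2 ℕ.+ k) k) (F (suc k) j) (F (suc k) (suc j)) (F (2 ℕ.+ k) j + F k j) (F (2 ℕ.+ k) (suc j) + F k (suc j))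
      {{ℤ.>-nonZero (positive (suc k) (suc j) (s≤s j<k) (subst (suc k ℕ.<_) (sym (ℕₚ.+-suc n j)) (s≤s k<n+j)))}}
      (minors-proportional (F k j) (F (suc k) j) (F (2 ℕ.+ k) j) (F k (suc j)) (F (suc k) (suc j)) (F (2 ℕ.+ k) (suc j)) (+ R * + R)
        (diamond k j j<k k<n+j) (diamond (suc k) j (ℕₚ.m<n⇒m<1+n j<k) 1+k<n+j))
      (rowRecurrence d (suc j) k (ℕₚ.+-suc d j) (ℕₚ.<⇒≤ 3+d≤n))
    where
    j<k : j ℕ.< k
    j<k = s≤s (ℕₚ.m≤n+m j d)
    1+k<n+j : suc k ℕ.< n ℕ.+ j
    1+k<n+j = ℕₚ.+-monoˡ-≤ j 3+d≤n
    k<n+j : k ℕ.< n ℕ.+ j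
    k<n+j = ℕₚ.<-trans (ℕₚ.n<1+n k) 1+k<n+j

  -- The transposed argument, starting at row j + 2 and moving down. The coefficient F(j+2,j) is
  -- that of the row recurrence at k = j, the coincidence on which `glide` rests.
  columnRecurrence : ∀ d j → 2 ℕ.+ d ℕ.≤ n → let i = d ℕ.+ (2 ℕ.+ j) in
                     + R * (F i (2 ℕ.+ j) + F i j) ≡ F (2 ℕ.+ j) j * F i (suc j)
  columnRecurrence zero    j _ = trans (cong (+ R *_) (ℤₚ.+-comm (F (2 ℕ.+ j) (2 ℕ.+ j)) (F (2 ℕ.+ j) j)))
    (trans (start (F (2 ℕ.+ j) j) (diag₀ (2 ℕ.+ j))) (cong (F (2 ℕ.+ j) j *_) (sym (diag₁ (suc j)))))
  columnRecurrence (suc d) j 3+d≤n =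
    transfer (+ R) (F (2 ℕ.+ j) j) (F (suc i) (suc j)) (F i (suc j)) (F (suc i) (2 ℕ.+ j) + F (suc i) j) (F i (2 ℕ.+ j) + F i j)
      {{ℤ.>-nonZero (positive i (suc j) 1+j<i i<n+1+j)}}
      (sym (minors-proportional (F i j) (F i (suc j)) (F i (2 ℕ.+ j)) (F (suc i) j) (F (suc i) (suc j)) (F (suc i) (2 ℕ.+ j)) (+ R * + R)
        (trans (cong (λ t → F i j * F (suc i) (suc j) - t) (ℤₚ.*-comm (F (suc i) j) (F i (suc j))))
          (diamond i j (ℕₚ.<-trans (ℕₚ.n<1+n j) 1+j<i) i<n+j))
        (trans (cong (λ t → F i (suc j) * F (suc i) (2 ℕ.+ j) - t) (ℤₚ.*-comm (F (suc i) (suc j)) (F i (2 ℕ.+ j))))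
          (diamond i (suc j) 1+j<i i<n+1+j))))
      (columnRecurrence d j (ℕₚ.<⇒≤ 3+d≤n))
    where
    i = d ℕ.+ (2 ℕ.+ j)
    1+j<i : suc j ℕ.< i
    1+j<i = ℕₚ.m≤n+m (2 ℕ.+ j) d
    i<n+j : i ℕ.< n ℕ.+ j
    i<n+j = subst (ℕ._≤ n ℕ.+ j) (cong suc (trans (cong (ℕ._+ j) (ℕₚ.+-comm 2 d)) (ℕₚ.+-assoc d 2 j))) (ℕₚ.+-monoˡ-≤ j 3+d≤n)
    i<n+1+j : i ℕ.< n ℕ.+ suc j
    i<n+1+j = subst (i ℕ.<_) (sym (ℕₚ.+-suc n j)) (ℕₚ.m<n⇒m<1+n i<n+j)

  -- Both sides start with 0, R and satisfy the same second-order recurrence in k, one by rows and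
  -- one by columns.
  glide : ∀ k → k ℕ.≤ n → F k 0 ≡ F n k
  glide zero          _ = trans (diag₀ 0) (sym (trans (cong (λ t → F t 0) (sym (ℕₚ.+-identityʳ n))) (diagₙ 0)))
  glide (suc zero)    _ = trans (diag₁ 0) (sym (trans (cong (λ t → F t 1) (sym (ℕₚ.+-identityʳ n))) (diagₙ₋₁ 0)))
  glide (suc (suc k)) 2+k≤n = ℤₚ.*-cancelˡ-≡ (+ R) (F (2 ℕ.+ k) 0) (F n (2 ℕ.+ k)) (begin
    + R * F (2 ℕ.+ k) 0                                     ≡⟨ next (+ R) l (F k 0) (F (suc k) 0) (F (2 ℕ.+ k) 0) (rowRecurrence k 0 k (ℕₚ.+-identityʳ k) 2+k≤n) ⟩
    l * F (suc k) 0 - + R * F k 0                           ≡⟨ cong₂ (λ x y → l * x - + R * y) (glide (suc k) (ℕₚ.<⇒≤ 2+k≤n)) (glide k (ℕₚ.<⇒≤ (ℕₚ.<⇒≤ 2+k≤n))) ⟩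
    l * F n (suc k) - + R * F n k                           ≡⟨ next (+ R) l (F n k) (F n (suc k)) (F n (2 ℕ.+ k)) col ⟨
    + R * F n (2 ℕ.+ k)                                     ∎)
    where
    open ≡-Reasoning
    l = F (2 ℕ.+ k) k
    d = n ℕ.∸ (2 ℕ.+ k)
    col : + R * (F n (2 ℕ.+ k) + F n k) ≡ l * F n (suc k)
    col = subst (λ i → + R * (F i (2 ℕ.+ k) + F i k) ≡ l * F i (suc k)) (ℕₚ.m∸n+n≡m 2+k≤n)
            (columnRecurrence d k (subst (2 ℕ.+ d ℕ.≤_) (ℕₚ.m∸n+n≡m 2+k≤n)
              (subst (ℕ._≤ d ℕ.+ (2 ℕ.+ k)) (ℕₚ.+-comm d 2) (ℕₚ.+-monoʳ-≤ d (ℕₚ.m≤m+n 2 k)))))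

  -- As functions of i both sides satisfy the row recurrence, whose coefficients are the same in the
  -- columns 0, 1 and j + 1. They agree at i = j + 1 trivially and at i = j + 2 by the diamond rule.
  ptolemy : ∀ d j → suc d ℕ.+ j ℕ.≤ n →
            let i = d ℕ.+ suc j in + R * F i (suc j) ≡ F (suc j) 0 * F i 1 - F (suc j) 1 * F i 0
  ptolemy zero j _ = trans (cong (+ R *_) (diag₀ (suc j)))
    (trans (ℤₚ.*-zeroʳ (+ R)) (h (F (suc j) 0) (F (suc j) 1)))
    where
    h : ∀ x y → + 0 ≡ x * y - y * x
    h = solve-∀
  ptolemy (suc zero) j 2+j≤n = trans (cong (+ R *_) (diag₁ (suc j)))
    (sym (diamond (suc j) 0 (s≤s z≤n) (subst (suc j ℕ.<_) (sym (ℕₚ.+-identityʳ n)) 2+j≤n)))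
  ptolemy (suc (suc d)) j 3+d+j≤n = ℤₚ.*-cancelˡ-≡ (+ R) _ _ (begin
    + R * (+ R * F (2 ℕ.+ k) (suc j))                        ≡⟨ cong (+ R *_) (recur (suc j) (rowRecurrence d (suc j) k refl (ℕₚ.m+n≤o⇒m≤o (2 ℕ.+ d) 2+d+j≤n))) ⟩
    + R * (l * F (suc k) (suc j) - + R * F k (suc j))        ≡⟨ h₁ (+ R) l (F (suc k) (suc j)) (F k (suc j)) ⟩
    l * (+ R * F (suc k) (suc j)) - + R * (+ R * F k (suc j)) ≡⟨ cong₂ (λ s t → l * s - + R * t) (ptolemy (suc d) j (ℕₚ.<⇒≤ 3+d+j≤n)) (ptolemy d j (ℕₚ.<⇒≤ (ℕₚ.<⇒≤ 3+d+j≤n))) ⟩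
    l * (x * F (suc k) 1 - y * F (suc k) 0) - + R * (x * F k 1 - y * F k 0)
                                                             ≡⟨ h₂ (+ R) l x y (F (suc k) 1) (F (suc k) 0) (F k 1) (F k 0) ⟩
    x * (l * F (suc k) 1 - + R * F k 1) - y * (l * F (suc k) 0 - + R * F k 0)
                                                             ≡⟨ cong₂ (λ s t → x * s - y * t)
                                                                  (recur 1 (rowRecurrence (d ℕ.+ j) 1 k (trans (ℕₚ.+-assoc d j 1) (cong (d ℕ.+_) (ℕₚ.+-comm j 1))) 2+d+j≤n))
                                                                  (recur 0 (rowRecurrence k 0 k (ℕₚ.+-identityʳ k) 2+k≤n)) ⟨
    x * (+ R * F (2 ℕ.+ k) 1) - y * (+ R * F (2 ℕ.+ k) 0)    ≡⟨ h₃ (+ R) x y (F (2 ℕ.+ k) 1) (F (2 ℕ.+ k) 0) ⟩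
    + R * (x * F (2 ℕ.+ k) 1 - y * F (2 ℕ.+ k) 0)            ∎)
    where
    open ≡-Reasoning
    k = d ℕ.+ suc j
    l = F (2 ℕ.+ k) k
    x = F (suc j) 0
    y = F (suc j) 1
    recur : ∀ c → + R * (F (2 ℕ.+ k) c + F k c) ≡ l * F (suc k) c → + R * F (2 ℕ.+ k) c ≡ l * F (suc k) c - + R * F k c
    recur c = next (+ R) l (F k c) (F (suc k) c) (F (2 ℕ.+ k) c)
    2+k≤n : 2 ℕ.+ k ℕ.≤ n
    2+k≤n = subst (ℕ._≤ n) (cong (2 ℕ.+_) (sym (ℕₚ.+-suc d j))) 3+d+j≤n
    2+d+j≤n : 2 ℕ.+ (d ℕ.+ j) ℕ.≤ n
    2+d+j≤n = ℕₚ.<⇒≤ 3+d+j≤n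
    h₁ : ∀ r l s t → r * (l * s - r * t) ≡ l * (r * s) - r * (r * t)
    h₁ = solve-∀
    h₂ : ∀ r l x y a b c d → l * (x * a - y * b) - r * (x * c - y * d) ≡ x * (l * a - r * c) - y * (l * b - r * d)
    h₂ = solve-∀
    h₃ : ∀ r x y a b → x * (r * a) - y * (r * b) ≡ r * (x * a - y * b)
    h₃ = solve-∀

module _ (R n : ℕ) (z : ℤ → ℤ → ℤ) (Z : IsIntFrieze R n z) where
  open IsIntFrieze Z

  -- The origin t is kept free: the glide symmetry is used at every t, the Ptolemy relation at t =
  -- -1.
  isGrid : ∀ t → IsGrid R n (λ i j → z (t + + i) (t + + j))
  isGrid t = record
    { diag₀    = λ i → diag₀ (t + + i)
    ; diagₙ    = λ i → trans (cong (λ s → z s (t + + i)) (shiftₙ i)) (diagₙ (t + + i))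
    ; diag₁    = λ i → trans (cong (λ s → z s (t + + i)) (shift₁ i)) (diag₁ (t + + i))
    ; diagₙ₋₁  = λ i → trans (cong₂ z (shiftₙ i) (shift₁ i)) (diagₙ₋₁ (t + + i))
    ; diamond  = λ i j j<i i<n+j → trans
        (cong₂ (λ s u → z (t + + i) (t + + j) * z s u - z (t + + i) u * z s (t + + j)) (shift₁ i) (shift₁ j))
        (diamond (t + + i) (t + + j) (interior′ i j j<i i<n+j))
    ; positive = λ i j j<i i<n+j → positive (t + + i) (t + + j) (interior′ i j j<i i<n+j)
    }
    where
    shiftₙ : ∀ i → t + + (n ℕ.+ i) ≡ t + + i + + n
    shiftₙ i = h t (+ n) (+ i)
      where
      h : ∀ t n i → t + (n + i) ≡ t + i + n
      h = solve-∀
    shift₁ : ∀ i → t + + suc i ≡ t + + i + + 1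
    shift₁ i = h t (+ i)
      where
      h : ∀ t i → t + (+ 1 + i) ≡ t + i + + 1
      h = solve-∀
    interior′ : ∀ i j → j ℕ.< i → i ℕ.< n ℕ.+ j → Interior n (t + + i) (t + + j)
    interior′ i j j<i i<n+j with ℕₚ.m≤n⇒∃[o]m+o≡n j<i
    ... | o , refl = interior (t + + i) (t + + j) o (h t (+ j) (+ o))
                       (ℕₚ.+-cancelʳ-< j (suc o) n (subst (ℕ._< n ℕ.+ j) (cong suc (ℕₚ.+-comm j o)) i<n+j))
      where
      h : ∀ t j o → t + (+ 1 + (j + o)) - (t + j) ≡ + 1 + o
      h = solve-∀

-- Antiperiodic extension from one period.

iterNeg : ℤ → Vec2 → Vec2
iterNeg (+ zero)     u = u
iterNeg (+ suc k)    u = neg (iterNeg (+ k) u)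
iterNeg -[1+ zero ]  u = neg u
iterNeg -[1+ suc k ] u = neg (iterNeg -[1+ k ] u)

neg-involutive : ∀ u → neg (neg u) ≡ u
neg-involutive (a , b) = cong₂ _,_ (ℤₚ.neg-involutive a) (ℤₚ.neg-involutive b)

iterNeg-suc : ∀ q u → iterNeg (q + + 1) u ≡ neg (iterNeg q u)
iterNeg-suc (+ k)        u = cong (λ t → iterNeg (+ t) u) (ℕₚ.+-comm k 1)
iterNeg-suc -[1+ zero ]  u = sym (neg-involutive u)
iterNeg-suc -[1+ suc k ] u = sym (neg-involutive (iterNeg -[1+ k ] u))

module _ (n : ℕ) .{{_ : NonZero n}} where

  private
    -- If p < q, then r + p n < (1 + p) n ≤ q n ≤ s + q n, against the equation.
    quotient-≤ : ∀ {r s : ℕ} {p q : ℤ} → r ℕ.< n → + r + p * + n ≡ + s + q * + n → q ≤ p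
    quotient-≤ {r} {s} {p} {q} r<n eq = ℤₚ.≮⇒≥ λ p<q → ℤₚ.<-irrefl eq (ℤₚ.<-≤-trans
      (ℤₚ.+-monoˡ-< (p * + n) (+<+ r<n))
      (ℤₚ.≤-trans (ℤₚ.≤-reflexive (h p (+ n)))
        (ℤₚ.≤-trans (ℤₚ.*-monoʳ-≤-nonNeg (+ n) (ℤₚ.i<j⇒suc[i]≤j p<q)) (ℤₚ.i≤j+i (q * + n) (+ s)))))
      where
      h : ∀ p n → n + p * n ≡ (+ 1 + p) * n
      h = solve-∀

  divMod-unique : ∀ {r s : ℕ} {p q : ℤ} → r ℕ.< n → s ℕ.< n → + r + p * + n ≡ + s + q * + n → r ≡ s × p ≡ q
  divMod-unique {r} {s} {p} {q} r<n s<n eq = ℤₚ.+-injective (ℤ+.∙-cancelʳ (p * + n) (+ r) (+ s) (trans eq (cong (λ t → + s + t * + n) (sym p≡q)))) , p≡q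
    where
    p≡q : p ≡ q
    p≡q = ℤₚ.≤-antisym (quotient-≤ s<n (sym eq)) (quotient-≤ r<n eq)

  extend : (ℕ → Vec2) → ℤ → Vec2
  extend b i = iterNeg (i /ℕ n) (b (i %ℕ n))

  extend-divMod : ∀ b i r q → r ℕ.< n → i ≡ + r + q * + n → extend b i ≡ iterNeg q (b r)
  extend-divMod b i r q r<n i≡ with divMod-unique (n%ℕd<d i n) r<n (trans (sym (a≡a%ℕn+[a/ℕn]*n i n)) i≡)
  ... | r≡ , q≡ = cong₂ (λ q r → iterNeg q (b r)) q≡ r≡

  extend-base : ∀ b r → r ℕ.< n → extend b (+ r) ≡ b r
  extend-base b r r<n = extend-divMod b (+ r) r (+ 0) r<n (h (+ r) (+ n))
    where
    h : ∀ r n → r ≡ r + + 0 * n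
    h = solve-∀

  extend-antiperiodic : ∀ b → Antiperiodic n (extend b)
  extend-antiperiodic b i = trans (extend-divMod b (i + + n) (i %ℕ n) (i /ℕ n + + 1) (n%ℕd<d i n)
      (trans (cong (_+ + n) (a≡a%ℕn+[a/ℕn]*n i n)) (h (+ (i %ℕ n)) (i /ℕ n) (+ n))))
    (iterNeg-suc (i /ℕ n) (b (i %ℕ n)))
    where
    h : ∀ r q n → r + q * n + n ≡ r + (q + + 1) * n
    h = solve-∀

module _ (R n : ℕ) .{{_ : NonZero R}} (v : ℤ → Vec2) (anti : Antiperiodic n v)
         (edge : ∀ i → det (v i) (v (i + + 1)) ≡ + R)
         (det-pos : ∀ i j → + 0 ≤ i → i < j → j < + n → + 0 < det (v i) (v j)) where

  private
    pos≢0 : ∀ {i} → + 0 < i → i ≢ + 0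
    pos≢0 0<i i≡0 = ℤₚ.<-irrefl (sym i≡0) 0<i

    edge≢0 : ∀ i → det (v i) (v (i + + 1)) ≢ + 0
    edge≢0 i e = ℕ.≢-nonZero⁻¹ R (ℤₚ.+-injective (trans (sym (edge i)) e))

    nonZero : ∀ i → NonZeroVec (v i)
    nonZero i = 0≢det⇒NonZeroˡ (v i) (v (i + + 1)) (edge≢0 i)

    gcd∣det : ∀ u w → gcd (proj₁ u) (proj₂ u) ∣ det u w
    gcd∣det (a , b) (c , d) = ∣m∣n⇒∣m-n (∣m⇒∣m*n d (∣ᵤ⇒∣ {gcd a b} {a} (gcd[i,j]∣i a b))) (∣m⇒∣m*n c (∣ᵤ⇒∣ {gcd a b} {b} (gcd[i,j]∣j a b)))

  positive⇒path : ClosedCWPath R n v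
  positive⇒path = record
    { antiperiodic = anti
    -- The gcd of the coordinates of v_i divides every determinant with v_i, in particular the edge
    -- R.
    ; vertices     = λ i _ → nonZero i , ∣⇒∣ᵤ (subst (gcd (proj₁ (v i)) (proj₂ (v i)) ∣_) (edge i) (gcd∣det (v i) (v (i + + 1))))
    ; edges        = λ i _ _ → trans (cong (λ t → det (v (i - + 1)) (v t)) (h i)) (edge (i - + 1))
    ; distinct     = λ i j 0≤i i<j j<n → det≢0⇒point≢ (v i) (v j) (pos≢0 (det-pos i j 0≤i i<j j<n))
    ; clockwise    = λ i j k 0≤i i<j j<k k<n → orientation⇒clockwise (v i) (v j) (v k) (nonZero i) (nonZero j) (nonZero k)
                       (*-pos (*-pos (det-pos i j 0≤i i<j (ℤₚ.<-trans j<k k<n))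
                                     (det-pos j k (ℤₚ.≤-trans 0≤i (ℤₚ.<⇒≤ i<j)) j<k k<n))
                              (det-pos i k 0≤i (ℤₚ.<-trans i<j j<k) k<n))
    }
    where
    h : ∀ i → i ≡ i - + 1 + + 1
    h = solve-∀

-- Makes a choice that exists only under a decidable condition into a total one, with a default
-- elsewhere. Base vectors and numerators thus become plain functions of their indices.
extendPartial : ∀ {A : Set} (P : Set) {Q : A → Set} → Dec P → A → (P → ∃ Q) → ∃ λ a → P → Q a
extendPartial P (yes p) _ f = proj₁ (f p) , λ _ → proj₂ (f p)
extendPartial P (no ¬p) a _ = a , λ p → ⊥-elim (¬p p)

module Realise (R n : ℕ) .{{_ : NonZero R}} .{{_ : NonZero n}} (z : ℤ → ℤ → ℤ) (Z : IsIntFrieze R n z) where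
  open IsIntFrieze Z

  private
    instance
      R≢0 : ℤ.NonZero (+ R)
      R≢0 = ℤ.≢-nonZero λ R≡0 → ℕ.≢-nonZero⁻¹ R (ℤₚ.+-injective R≡0)

    -- For n = 1 the entry z(1,1) would be both R and 0.
    1≢n : 1 ≢ n
    1≢n refl = ℕ.≢-nonZero⁻¹ R (ℤₚ.+-injective (trans (sym (diagₙ₋₁ (+ 0))) (diag₀ (+ 1))))

    1<n : 1 ℕ.< n
    1<n = ℕₚ.≤∧≢⇒< (ℕ.>-nonZero⁻¹ n) 1≢n

    -- The vectors (x_r , y_r) have determinants R z, so they realise the frieze up to a factor R.
    -- In columns -1 and 0 all rows 0, ..., n-1 lie in the strip.
    x y : ℕ → ℤ
    x r = z (+ r) -[1+ 0 ]
    y r = z (+ r) (+ 0)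

    module G₋₁ = Grid R n (λ i j → z (-[1+ 0 ] + + i) (-[1+ 0 ] + + j)) (isGrid R n z Z -[1+ 0 ])

    ptolemy : ∀ j i → j ℕ.≤ i → i ℕ.< n → + R * z (+ i) (+ j) ≡ x j * y i - y j * x i
    ptolemy j i j≤i i<n with ℕₚ.m≤n⇒∃[o]m+o≡n j≤i
    ... | d , refl = subst (λ s → + R * z (-[1+ 0 ] + + s) (+ j) ≡ x j * z (-[1+ 0 ] + + s) (+ 0) - y j * z (-[1+ 0 ] + + s) -[1+ 0 ])
                       (trans (ℕₚ.+-suc d j) (cong suc (ℕₚ.+-comm d j))) (G₋₁.ptolemy d j (subst (ℕ._< n) (ℕₚ.+-comm j d) i<n))

    ∣minor : ∀ i j → i ℕ.< n → j ℕ.< n → + R ∣ x i * y j - x j * y i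
    ∣minor i j i<n j<n with ℕₚ.≤-total i j
    ... | inj₁ i≤j = divides (z (+ j) (+ i)) (trans (h (x i) (y j) (x j) (y i)) (trans (sym (ptolemy i j i≤j j<n)) (ℤₚ.*-comm (+ R) _)))
      where
      h : ∀ a b c d → a * b - c * d ≡ a * b - d * c
      h = solve-∀
    ... | inj₂ j≤i = divides (- z (+ i) (+ j)) (trans (h (x i) (y j) (x j) (y i)) (trans (cong -_ (sym (ptolemy j i j≤i i<n))) (h′ (+ R) _)))
      where
      h : ∀ a b c d → a * b - c * d ≡ - (c * d - b * a)
      h = solve-∀
      h′ : ∀ r z → - (r * z) ≡ (- z) * r
      h′ = solve-∀

    -- The multipliers s for which some combination x s - q y is divisible by R in every row. Each
    -- y_k is one, with q = x_k, because R divides the 2×2 minors; hence so is the gcd of the y_k.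
    Compatible : ℤ → Set
    Compatible s = ∃ λ q → ∀ r → r ℕ.< n → + R ∣ x r * s - q * y r

    compatible-ideal : IsIdeal Compatible
    compatible-ideal = record
      { has0 = + 0 , λ r _ → divides (+ 0) (h₀ (x r) (y r))
      ; comb = λ { α β {a} {b} (p , R∣p) (q , R∣q) → α * p + β * q , λ r r<n →
          subst (+ R ∣_) (h₁ (x r) (y r) α β a b p q) (∣m∣n⇒∣m+n (∣n⇒∣m*n α (R∣p r r<n)) (∣n⇒∣m*n β (R∣q r r<n))) }
      }
      where
      h₀ : ∀ x y → x * + 0 - + 0 * y ≡ + 0
      h₀ = solve-∀
      h₁ : ∀ x y α β a b p q → α * (x * a - p * y) + β * (x * b - q * y) ≡ x * (α * a + β * b) - (α * p + β * q) * y
      h₁ = solve-∀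

    gcdColumn : ∃ λ s → Compatible s × (∀ r → r ℕ.< n → s ∣ y r)
    gcdColumn = commonDivisor compatible-ideal (λ r s → s ∣ y r) (λ r → ∣-trans) n
      λ k k<n → y k , (x k , λ r r<n → ∣minor r k r<n k<n) , divides (+ 1) (sym (ℤₚ.*-identityˡ (y k)))

    s q : ℤ
    s = proj₁ gcdColumn
    q = proj₁ (proj₁ (proj₂ gcdColumn))

    instance
      s≢0 : ℤ.NonZero s
      -- s divides y_1 = R, and row 1 is in range because 1 < n.
      s≢0 = ℤ.≢-nonZero λ s≡0 → R≢ (divisor s≡0 (proj₂ (proj₂ gcdColumn) 1 1<n))
        where
        R≢ : + R ≢ + 0
        R≢ R≡0 = ℕ.≢-nonZero⁻¹ R (ℤₚ.+-injective R≡0)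
        divisor : s ≡ + 0 → s ∣ y 1 → + R ≡ + 0
        divisor s≡0 (divides t eq) = trans (sym (diag₁ (+ 0))) (trans eq (trans (cong (t *_) s≡0) (ℤₚ.*-zeroʳ t)))

    IsBase : ℕ → Vec2 → Set
    IsBase r (a , b) = (x r * s - q * y r ≡ a * + R) × (y r ≡ b * s)

    based : ∀ r → ∃ λ u → r ℕ.< n → IsBase r u
    based r = extendPartial (r ℕ.< n) (r ℕₚ.<? n) (+ 0 , + 0) λ r<n →
      pair (proj₂ (proj₁ (proj₂ gcdColumn)) r r<n) (proj₂ (proj₂ gcdColumn) r r<n)
      where
      pair : + R ∣ x r * s - q * y r → s ∣ y r → ∃ (IsBase r)
      pair (divides a eqa) (divides b eqb) = (a , b) , eqa , eqb

    base : ℕ → Vec2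
    base r = proj₁ (based r)

    -- The map from (x , y) to ((x s - q y) / R , y / s) has determinant 1 / R, which turns R z into
    -- z. The proof clears both denominators.
    det-isBase : ∀ j i u w → IsBase j u → IsBase i w → j ℕ.≤ i → i ℕ.< n → det u w ≡ z (+ i) (+ j)
    det-isBase j i (a , b) (c , d) (eqa , eqb) (eqc , eqd) j≤i i<n =
      ℤₚ.*-cancelʳ-≡ _ _ (+ R) (ℤₚ.*-cancelʳ-≡ _ _ s (begin
        (a * d - b * c) * + R * s                                            ≡⟨ h₁ a b c d (+ R) s ⟩
        a * + R * (d * s) - b * s * (c * + R)                                ≡⟨ cong₂ _-_ (cong₂ _*_ eqa eqd) (cong₂ _*_ eqb eqc) ⟨
        (x j * s - q * y j) * y i - y j * (x i * s - q * y i)                ≡⟨ h₂ (x j) (y j) (x i) (y i) s q ⟩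
        (x j * y i - y j * x i) * s                                          ≡⟨ cong (_* s) (ptolemy j i j≤i i<n) ⟨
        + R * z (+ i) (+ j) * s                                              ≡⟨ cong (_* s) (ℤₚ.*-comm (+ R) (z (+ i) (+ j))) ⟩
        z (+ i) (+ j) * + R * s                                              ∎))
      where
      open ≡-Reasoning
      h₁ : ∀ a b c d r s → (a * d - b * c) * r * s ≡ a * r * (d * s) - b * s * (c * r)
      h₁ = solve-∀
      h₂ : ∀ x y x′ y′ s q → (x * s - q * y) * y′ - y * (x′ * s - q * y′) ≡ (x * y′ - y * x′) * s
      h₂ = solve-∀

  v : ℤ → Vec2
  v = extend n base

  antiperiodic : Antiperiodic n v
  antiperiodic = extend-antiperiodic n base

  private
    det-base : ∀ j i → j ℕ.≤ i → i ℕ.< n → det (v (+ j)) (v (+ i)) ≡ z (+ i) (+ j)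
    det-base j i j≤i i<n = trans (cong₂ det (extend-base n base j j<n) (extend-base n base i i<n))
        (det-isBase j i (base j) (base i) (proj₂ (based j) j<n) (proj₂ (based i) i<n) j≤i i<n)
      where
      j<n = ℕₚ.≤-<-trans j≤i i<n

    glide : ∀ t k → k ℕ.≤ n → z (t + + k) t ≡ z (t + + n) (t + + k)
    glide t k k≤n = subst (λ s → z (t + + k) s ≡ z (t + + n) (t + + k)) (ℤₚ.+-identityʳ t)
                      (Grid.glide R n (λ i j → z (t + + i) (t + + j)) (isGrid R n z Z t) k k≤n)

    -- Two glide reflections, by k from t and by n - k from t + k, compose to the translation by n.
    z-shift : ∀ t k → k ℕ.≤ n → z (t + + n + + k) (t + + n) ≡ z (t + + k) t
    z-shift t k k≤n = sym (trans (glide t k k≤n) (trans (cong (λ s → z s (t + + k)) (sym e₁))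
        (trans (glide (t + + k) (n ℕ.∸ k) (ℕₚ.m∸n≤m n k)) (cong₂ z (swap-shift t (+ n) (+ k)) e₁))))
      where
      e₁ : t + + k + + (n ℕ.∸ k) ≡ t + + n
      e₁ = trans (ℤₚ.+-assoc t (+ k) (+ (n ℕ.∸ k))) (cong (λ m → t + + m) (ℕₚ.m+[n∸m]≡n k≤n))

  det≡z-offset : ∀ j k → k ℕ.≤ n → det (v j) (v (j + + k)) ≡ z (j + + k) j
  det≡z-offset = periodic-induction n _
    (λ j e k k≤n → trans (det-shift antiperiodic j (+ k)) (trans (e k k≤n) (sym (z-shift j k k≤n))))
    (λ j e k k≤n → trans (sym (det-shift antiperiodic j (+ k))) (trans (e k k≤n) (z-shift j k k≤n)))
    onPeriod
    where
    onPeriod : ∀ r → r ℕ.< n → ∀ k → k ℕ.≤ n → det (v (+ r)) (v (+ r + + k)) ≡ z (+ r + + k) (+ r)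
    onPeriod r r<n k k≤n with r ℕ.+ k ℕₚ.<? n
    ... | yes inside = det-base r (r ℕ.+ k) (ℕₚ.m≤m+n r k) inside
    -- Here r + k = t + n with t ≤ r. Antiperiodicity takes the determinant, and the glide symmetry
    -- the entry, to row r and column t.
    ... | no outside with ℕₚ.m≤n⇒∃[o]m+o≡n (ℕₚ.≮⇒≥ outside)
    ... | t , n+t≡ = begin
      det (v (+ r)) (v (+ (r ℕ.+ k)))          ≡⟨ cong (λ i → det (v (+ r)) (v (+ i))) t+n≡ ⟨
      det (v (+ r)) (v (+ t + + n))            ≡⟨ det-wrap antiperiodic (+ r) (+ t) ⟩
      det (v (+ t)) (v (+ r))                  ≡⟨ det-base t r t≤r r<n ⟩
      z (+ r) (+ t)                            ≡⟨ cong (λ i → z (+ i) (+ t)) t+[r∸t]≡r ⟨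
      z (+ t + + (r ℕ.∸ t)) (+ t)              ≡⟨ glide (+ t) (r ℕ.∸ t) (ℕₚ.≤-trans (ℕₚ.m∸n≤m r t) (ℕₚ.<⇒≤ r<n)) ⟩
      z (+ t + + n) (+ t + + (r ℕ.∸ t))        ≡⟨ cong₂ (λ i j → z (+ i) (+ j)) t+n≡ t+[r∸t]≡r ⟩
      z (+ (r ℕ.+ k)) (+ r)                    ∎
      where
      open ≡-Reasoning
      t+n≡ : t ℕ.+ n ≡ r ℕ.+ k
      t+n≡ = trans (ℕₚ.+-comm t n) n+t≡
      t≤r : t ℕ.≤ r
      t≤r = ℕₚ.+-cancelˡ-≤ n t r (subst₂ ℕ._≤_ (sym n+t≡) (ℕₚ.+-comm r n) (ℕₚ.+-monoʳ-≤ r k≤n))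
      t+[r∸t]≡r : t ℕ.+ (r ℕ.∸ t) ≡ r
      t+[r∸t]≡r = ℕₚ.m+[n∸m]≡n t≤r

  det≡z : ∀ i j → InStrip n i j → det (v j) (v i) ≡ z i j
  det≡z i j strip with strip-offset i j strip
  ... | k , k≤n , refl = det≡z-offset j k k≤n

  path : ClosedCWPath R n v
  path = positive⇒path R n v antiperiodic
    (λ i → trans (det≡z-offset i 1 (ℕₚ.<⇒≤ 1<n)) (diag₁ i))
    λ i j 0≤i i<j j<n → subst (+ 0 <_) (sym (det≡z j i (ℤₚ.i≤j⇒0≤j-i (ℤₚ.<⇒≤ i<j) , ℤₚ.<⇒≤ (j-i<n i j 0≤i j<n))))
      (positive j i (i<j⇒0<j-i i<j , j-i<n i j 0≤i j<n))
    where
    j-i<n : ∀ i j → + 0 ≤ i → j < + n → j - i < + n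
    j-i<n (+ i) j _ j<n = ℤₚ.≤-<-trans (ℤₚ.i-j≤i j (+ i)) j<n

-- Assembly of the correspondence.

module _ (K R n : ℕ) .{{_ : NonZero K}} .{{_ : NonZero R}} .{{_ : NonZero n}} where

  private
    KR≢0 : NonZero (K ℕ.* R)
    KR≢0 = ℕₚ.m*n≢0 K R

    inStrip? : ∀ i j → Dec (InStrip n i j)
    inStrip? i j with + 0 ℤₚ.≤? i - j | i - j ℤₚ.≤? + n
    ... | yes p | yes q = yes (p , q)
    ... | no ¬p | _     = no λ { (p , _) → ¬p p }
    ... | _     | no ¬q = no λ { (_ , q) → ¬q q }

  -- Divisibility by K sharpens the denominator from N to R: N m = K a and N = K R give m = a / R.
  integral : ∀ m → GCDIs (K ℕ.* R) n K m → ∃ λ (z : ℤ → ℤ → ℤ) → ∀ i j → InStrip n i j → m i j ≡ z i j ℚ./ R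
  integral m (K∣m , _) = (λ i j → proj₁ (entry i j)) , λ i j → proj₂ (entry i j)
    where
    unscale : ∀ p → (+ K) ∣ℚ scale (K ℕ.* R) p → ∃ λ a → p ≡ a ℚ./ R
    unscale p (k , eq) = k , scale-injective (K ℕ.* R) {{KR≢0}} p (k ℚ./ R)
      (trans eq (trans (cong (ℚ._/ 1) (ℤₚ.*-comm k (+ K))) (sym (scale-/ K R k))))
    entry : ∀ i j → ∃ λ a → InStrip n i j → m i j ≡ a ℚ./ R
    entry i j = extendPartial (InStrip n i j) (inStrip? i j) (+ 0) (λ strip → unscale (m i j) (K∣m i j strip))

  realise : ∀ m → PositiveFriezeGCD (K ℕ.* R) n K m →
            Σ (ℤ → Vec2) λ v → MinimalClosedCWPath R n v × (friezeOf R v ≈[ n ] m)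
  realise m (frieze , pos , _ , gcdK) = build (integral m gcdK)
    where
    build : (∃ λ (z : ℤ → ℤ → ℤ) → ∀ i j → InStrip n i j → m i j ≡ z i j ℚ./ R) →
            Σ (ℤ → Vec2) λ v → MinimalClosedCWPath R n v × (friezeOf R v ≈[ n ] m)
    build (z , m≡z/R) = v , (path , GCDIs⇒minimal K R n v path m v≈m gcdK) , v≈m
      where
      open Realise R n z (frieze⇒intFrieze R n m z m≡z/R frieze pos)
      v≈m : friezeOf R v ≈[ n ] m
      v≈m i j strip = trans (cong (ℚ._/ R) (det≡z i j strip)) (sym (m≡z/R i j strip))

theoremB : (N K R : ℕ) → .{{_ : NonZero N}} → .{{_ : NonZero K}} → .{{_ : NonZero R}} →
    N ≡ K ℕ.* R → (n : ℕ) → .{{_ : NonZero n}} →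
    (∀ v → MinimalClosedCWPath R n v → PositiveFriezeGCD N n K (friezeOf R v))
    × (∀ v (g : SL₂ℤ) → MinimalClosedCWPath R n v →
    friezeOf R (actPath g v) ≈[ n ] friezeOf R v)
    × (∀ v w → MinimalClosedCWPath R n v → MinimalClosedCWPath R n w →
    friezeOf R v ≈[ n ] friezeOf R w → SameOrbit v w)
    × (∀ (m : Array) → PositiveFriezeGCD N n K m →
    Σ (ℤ → Vec2) λ v → MinimalClosedCWPath R n v × (friezeOf R v ≈[ n ] m))
theoremB _ K R refl n =
  (λ v (path , minimal) → minimalPath⇒frieze K R n v path minimal) ,
  (λ v g _ i j _ → cong (ℚ._/ R) (det-act g (v j) (v i))) ,
  (λ v w (pathᵛ , minimal) (pathʷ , _) → sameFrieze⇒sameOrbit R n v w pathᵛ pathʷ minimal) ,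
  realise K R n
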